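{- Let $A$ be a reduced ring. Let $B$ be an $A$-algebra of finite type. Let $M$ be a finitely generated $B$-module. Suppose that $f=0$ is the only element of $A$ such that (1) $B[f^{ -1}]$ and $M[f^{ -1}]$ are free modules over $A[f^{ -1}]$, (2) $A[f^{ -1}]\to B[f^{ -1}]$ is of finite presentation, and (3) $M[f^{ -1}]$ is finitely presented as a module over $B[f^{ -1}]$. Then $1=0$ in $A$.
   Context: The metatheory is constructive (no law of excluded middle, no axiom of choice). A ring is a commutative ring with unit (possibly trivial); it is reduced iff $x^n=0$ implies $x=0$. For any $f\in A$, $A[f^{ -1}]$, $B[f^{ -1}]$, $M[f^{ -1}]$ denote the localizations away from $f$; this makes sense also for $f$ zero or nilpotent, in which case they are trivial. -}

module Defs where

open import Algebra.Bundles using (CommutativeRing; CommutativeMonoid; RawMonoid)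
open import Algebra.Module.Bundles using (Module)
open import Algebra.Module.Construct.TensorUnit using (⟨module⟩)
open import Algebra.Module.Morphism.Structures using (IsModuleIsomorphism)
open import Algebra.Module.Structures using (IsModule; IsLeftModule)
open import Algebra.Module.Structures.Biased using (module IsModuleFromLeft)
open import Algebra.Morphism.Structures using (IsRingHomomorphism)
open import Algebra.Structures using (IsCommutativeRing; IsAbelianGroup; IsCommutativeMonoid)
open import Data.List.Base using (List; []; _∷_; _++_; map)
open import Data.List.Properties using (++-assoc; map-++)
open import Data.Nat.Base as ℕ using (ℕ)
open import Data.Product.Base using (Σ; ∃; _×_; _,_; proj₁; proj₂)
open import Data.Vec.Base as Vec using (Vec; lookup; replicate; zipWith)
open import Data.Vec.Functional using (Vector)
open import Function.Base using (flip)
open import Level using (Level; _⊔_; suc; 0ℓ)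
open import Relation.Binary.Bundles using (Setoid)
open import Relation.Binary.Structures using (IsEquivalence)
open import Relation.Binary.PropositionalEquality as ≡ using (_≡_)
import Algebra.Definitions.RawMonoid as RawMonoidDefs
import Algebra.Module.Properties as ModuleProperties
import Algebra.Properties.AbelianGroup as AbelianGroupProperties
import Algebra.Properties.CommutativeSemigroup as CommutativeSemigroupProperties
import Algebra.Properties.Ring as RingProperties
import Algebra.Properties.Semiring.Exp as Exp
import Algebra.Solver.CommutativeMonoid as MonoidSolver
import Data.Nat.Properties as ℕ
import Data.Vec.Properties as Vec
import Relation.Binary.Reasoning.Setoid as ≈-Reasoning

private
  module ℕSolver = MonoidSolver ℕ.+-0-commutativeMonoid

open CommutativeRing using (Carrier)

IsReduced : {r ℓr : Level} → CommutativeRing r ℓr → Set (r ⊔ ℓr)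
IsReduced R = ∀ x n → x ^ n ≈ 0# → x ≈ 0#
  where
  open CommutativeRing R
  open Exp semiring using (_^_)

module _ {r ℓr m ℓm : Level} {R : CommutativeRing r ℓr} (M : Module R m ℓm) where

  open Module M
  open RawMonoidDefs +ᴹ-rawMonoid using (sum)
  private
    module R where
      open CommutativeRing R public
      open RawMonoidDefs +-rawMonoid public using (sum)

  linearCombination : {n : ℕ} → Vector (Carrier R) n → Vector Carrierᴹ n → Carrierᴹ
  linearCombination c v = sum (λ i → c i *ₗ v i)

  IsGeneratedBy : {n : ℕ} → Vector Carrierᴹ n → Set (r ⊔ m ⊔ ℓm)
  IsGeneratedBy v = ∀ x → ∃ λ c → linearCombination c v ≈ᴹ x

  IsFinitelyGenerated : Set (r ⊔ m ⊔ ℓm)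
  IsFinitelyGenerated = ∃ λ n → Σ (Vector Carrierᴹ n) IsGeneratedBy

  -- Exactness of R^k → R^n → M → 0, where the first map sends the
  -- standard basis vectors to the relations ρ j.
  IsFinitelyPresented : Set (r ⊔ ℓr ⊔ m ⊔ ℓm)
  IsFinitelyPresented =
    ∃ λ n → Σ (Vector Carrierᴹ n) λ v → IsGeneratedBy v ×
    ∃ λ k → Σ (Vector (Vector (Carrier R) n) k) λ ρ →
      (∀ j → linearCombination (ρ j) v ≈ᴹ 0ᴹ) ×
      (∀ c → linearCombination c v ≈ᴹ 0ᴹ →
         Σ (Vector R.Carrier k) λ d → ∀ i → R.sum (λ j → d j R.* ρ j i) R.≈ c i)

-- The free module R^(I) on a set I with an arbitrary (not necessarily
-- decidable) equality.
module Free {r ℓr i ℓi : Level} (R : CommutativeRing r ℓr) (I : Setoid i ℓi) where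

  private
    module R = CommutativeRing R
    module I = Setoid I
  open R using (_≈_; _+_; _*_; -_; 0#; 1#)

  -- A list of pairs (a , i) stands for the formal sum Σ a·i.
  FormalSum : Set (r ⊔ i)
  FormalSum = List (R.Carrier × I.Carrier)

  infix 4 _∼_

  data _∼_ : FormalSum → FormalSum → Set (r ⊔ ℓr ⊔ i ⊔ ℓi) where
    ∼-refl  : ∀ {p} → p ∼ p
    ∼-sym   : ∀ {p q} → p ∼ q → q ∼ p
    ∼-trans : ∀ {p q t} → p ∼ q → q ∼ t → p ∼ t
    ∼-cons  : ∀ {a b x y p q} → a ≈ b → x I.≈ y → p ∼ q → (a , x) ∷ p ∼ (b , y) ∷ q
    ∼-swap  : ∀ {t u p} → t ∷ u ∷ p ∼ u ∷ t ∷ p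
    ∼-merge : ∀ {a b x p} → (a , x) ∷ (b , x) ∷ p ∼ (a + b , x) ∷ p
    ∼-drop  : ∀ {x p} → (0# , x) ∷ p ∼ p

  scale : R.Carrier → FormalSum → FormalSum
  scale c = map (λ (a , x) → c * a , x)

  negate : FormalSum → FormalSum
  negate = map (λ (a , x) → - a , x)

  ∼-isEquivalence : IsEquivalence _∼_
  ∼-isEquivalence = record { refl = ∼-refl ; sym = ∼-sym ; trans = ∼-trans }

  ∼-setoid : Setoid (r ⊔ i) (r ⊔ ℓr ⊔ i ⊔ ℓi)
  ∼-setoid = record { isEquivalence = ∼-isEquivalence }

  ∼-reflexive : ∀ {p q} → p ≡ q → p ∼ q
  ∼-reflexive ≡.refl = ∼-refl

  ∼-prep : ∀ t {p q} → p ∼ q → t ∷ p ∼ t ∷ q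
  ∼-prep t = ∼-cons R.refl I.refl

  ++-congˡ : ∀ p {q t} → q ∼ t → p ++ q ∼ p ++ t
  ++-congˡ []      h = h
  ++-congˡ (u ∷ p) h = ∼-prep u (++-congˡ p h)

  ++-congʳ : ∀ t {p q} → p ∼ q → p ++ t ∼ q ++ t
  ++-congʳ t ∼-refl         = ∼-refl
  ++-congʳ t (∼-sym h)      = ∼-sym (++-congʳ t h)
  ++-congʳ t (∼-trans h h′) = ∼-trans (++-congʳ t h) (++-congʳ t h′)
  ++-congʳ t (∼-cons e f h) = ∼-cons e f (++-congʳ t h)
  ++-congʳ t ∼-swap         = ∼-swap
  ++-congʳ t ∼-merge        = ∼-merge
  ++-congʳ t ∼-drop         = ∼-drop

  ++-cong : ∀ {p q t u} → p ∼ q → t ∼ u → p ++ t ∼ q ++ u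
  ++-cong {q = q} {t = t} h h′ = ∼-trans (++-congʳ t h) (++-congˡ q h′)

  ++-shift : ∀ t p q → p ++ t ∷ q ∼ t ∷ p ++ q
  ++-shift t []      q = ∼-refl
  ++-shift t (u ∷ p) q = ∼-trans (∼-prep u (++-shift t p q)) ∼-swap

  ++-comm : ∀ p q → p ++ q ∼ q ++ p
  ++-comm []      q = ++-comm-[] q
    where
    ++-comm-[] : ∀ q → q ∼ q ++ []
    ++-comm-[] []      = ∼-refl
    ++-comm-[] (u ∷ q) = ∼-prep u (++-comm-[] q)
  ++-comm (t ∷ p) q = ∼-trans (∼-prep t (++-comm p q)) (∼-sym (++-shift t q p))

  ++-identityʳ : ∀ p → p ++ [] ∼ p
  ++-identityʳ p = ++-comm p []

  ++-isCommutativeMonoid : IsCommutativeMonoid _∼_ _++_ []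
  ++-isCommutativeMonoid = record
    { isMonoid = record
      { isSemigroup = record
        { isMagma = record { isEquivalence = ∼-isEquivalence ; ∙-cong = ++-cong }
        ; assoc   = λ p q t → ∼-reflexive (++-assoc p q t)
        }
      ; identity = (λ _ → ∼-refl) , ++-identityʳ
      }
    ; comm = ++-comm
    }

  ++-commutativeMonoid : CommutativeMonoid (r ⊔ i) (r ⊔ ℓr ⊔ i ⊔ ℓi)
  ++-commutativeMonoid = record { isCommutativeMonoid = ++-isCommutativeMonoid }

  scale-cong : ∀ {a b p q} → a ≈ b → p ∼ q → scale a p ∼ scale b q
  scale-cong {a} {b} {p} {q} e h = ∼-trans (left p) (right h)
    where
    left : ∀ p → scale a p ∼ scale b p
    left []      = ∼-refl
    left (_ ∷ p) = ∼-cons (R.*-congʳ e) I.refl (left p)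

    right : ∀ {p q} → p ∼ q → scale b p ∼ scale b q
    right ∼-refl          = ∼-refl
    right (∼-sym h)       = ∼-sym (right h)
    right (∼-trans h h′)  = ∼-trans (right h) (right h′)
    right (∼-cons e f h)  = ∼-cons (R.*-congˡ e) f (right h)
    right ∼-swap          = ∼-swap
    right ∼-merge         = ∼-trans ∼-merge (∼-cons (R.sym (R.distribˡ _ _ _)) I.refl ∼-refl)
    right ∼-drop          = ∼-trans (∼-cons (R.zeroʳ b) I.refl ∼-refl) ∼-drop

  scale-zeroˡ : ∀ p → scale 0# p ∼ []
  scale-zeroˡ []      = ∼-refl
  scale-zeroˡ (_ ∷ p) =
    ∼-trans (∼-cons (R.zeroˡ _) I.refl ∼-refl) (∼-trans ∼-drop (scale-zeroˡ p))

  scale-distribʳ : ∀ p a b → scale (a + b) p ∼ scale a p ++ scale b p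
  scale-distribʳ []            a b = ∼-refl
  scale-distribʳ ((c , x) ∷ p) a b = begin
    ((a + b) * c , x) ∷ scale (a + b) p                     ≈⟨ ∼-cons (R.distribʳ c a b) I.refl (scale-distribʳ p a b) ⟩
    (a * c + b * c , x) ∷ scale a p ++ scale b p            ≈⟨ ∼-merge ⟨
    (a * c , x) ∷ (b * c , x) ∷ scale a p ++ scale b p      ≈⟨ ∼-prep _ (++-shift _ (scale a p) (scale b p)) ⟨
    (a * c , x) ∷ scale a p ++ (b * c , x) ∷ scale b p      ∎
    where open ≈-Reasoning ∼-setoid

  scale-identityˡ : ∀ p → scale 1# p ∼ p
  scale-identityˡ []      = ∼-refl
  scale-identityˡ (_ ∷ p) = ∼-cons (R.*-identityˡ _) I.refl (scale-identityˡ p)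

  scale-assoc : ∀ a b p → scale (a * b) p ∼ scale a (scale b p)
  scale-assoc a b []      = ∼-refl
  scale-assoc a b (_ ∷ p) = ∼-cons (R.*-assoc a b _) I.refl (scale-assoc a b p)

  scale-distribˡ : ∀ a p q → scale a (p ++ q) ∼ scale a p ++ scale a q
  scale-distribˡ a p q = ∼-reflexive (map-++ _ p q)

  negate≈scale : ∀ p → negate p ∼ scale (- 1#) p
  negate≈scale []      = ∼-refl
  negate≈scale (_ ∷ p) =
    ∼-cons (R.sym (RingProperties.-1*x≈-x R.ring _)) I.refl (negate≈scale p)

  negate-cong : ∀ {p q} → p ∼ q → negate p ∼ negate q
  negate-cong {p} {q} h = begin
    negate p        ≈⟨ negate≈scale p ⟩
    scale (- 1#) p  ≈⟨ scale-cong R.refl h ⟩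
    scale (- 1#) q  ≈⟨ negate≈scale q ⟨
    negate q        ∎
    where open ≈-Reasoning ∼-setoid

  negate-inverseˡ : ∀ p → negate p ++ p ∼ []
  negate-inverseˡ p = begin
    negate p ++ p                  ≈⟨ ++-cong (negate≈scale p) (∼-sym (scale-identityˡ p)) ⟩
    scale (- 1#) p ++ scale 1# p   ≈⟨ scale-distribʳ p (- 1#) 1# ⟨
    scale (- 1# + 1#) p            ≈⟨ scale-cong (R.-‿inverseˡ 1#) ∼-refl ⟩
    scale 0# p                     ≈⟨ scale-zeroˡ p ⟩
    []                             ∎
    where open ≈-Reasoning ∼-setoid

  negate-inverseʳ : ∀ p → p ++ negate p ∼ []
  negate-inverseʳ p = ∼-trans (++-comm p (negate p)) (negate-inverseˡ p)

  -- The proofs of the module and ring laws are abstract throughout, so that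
  -- comparing types over the constructed rings does not unfold them.
  abstract
    isLeftModule : IsLeftModule R.ring _∼_ _++_ [] negate scale
    isLeftModule = record
      { isLeftSemimodule = record
        { +ᴹ-isCommutativeMonoid = ++-isCommutativeMonoid
        ; isPreleftSemimodule = record
          { *ₗ-cong      = scale-cong
          ; *ₗ-zeroˡ     = scale-zeroˡ
          ; *ₗ-distribʳ  = scale-distribʳ
          ; *ₗ-identityˡ = scale-identityˡ
          ; *ₗ-assoc     = scale-assoc
          ; *ₗ-zeroʳ     = λ _ → ∼-refl
          ; *ₗ-distribˡ  = scale-distribˡ
          }
        }
      ; -ᴹ‿cong    = negate-cong
      ; -ᴹ‿inverse = negate-inverseˡ , negate-inverseʳ
      }

  freeModule : Module R (r ⊔ i) (r ⊔ ℓr ⊔ i ⊔ ℓi)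
  freeModule = record
    { isModule = IsModuleFromLeft.isModule {commutativeRing = R}
        (record { isLeftModule = isLeftModule }) }

open Free public using (freeModule)

IsFree : {r ℓr m ℓm : Level} (i ℓi : Level) {R : CommutativeRing r ℓr} →
         Module R m ℓm → Set (suc i ⊔ suc ℓi ⊔ r ⊔ ℓr ⊔ m ⊔ ℓm)
IsFree i ℓi {R = R} M =
  Σ (Setoid i ℓi) λ I →
  ∃ (IsModuleIsomorphism (Module.rawModule (freeModule R I)) (Module.rawModule M))

-- The monoid algebra R[E], with underlying module the free module on E.
module MonoidAlgebra
  {r ℓr e ℓe : Level} (R : CommutativeRing r ℓr) (E : CommutativeMonoid e ℓe) where

  private
    module R = CommutativeRing R
    module E = CommutativeMonoid E
  open R using (_≈_; _+_; _*_; -_; 0#; 1#)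
  open E using (_∙_; ε)
  open Free R E.setoid

  shift : R.Carrier → E.Carrier → FormalSum → FormalSum
  shift a x = map (λ (b , y) → a * b , x ∙ y)

  infixl 7 _⊛_

  _⊛_ : FormalSum → FormalSum → FormalSum
  []            ⊛ q = []
  ((a , x) ∷ p) ⊛ q = shift a x q ++ p ⊛ q

  one : FormalSum
  one = (1# , ε) ∷ []

  open ≈-Reasoning ∼-setoid
  open CommutativeSemigroupProperties (CommutativeMonoid.commutativeSemigroup ++-commutativeMonoid)
    using (x∙yz≈y∙xz)

  shift-congʳ : ∀ {a x p q} → p ∼ q → shift a x p ∼ shift a x q
  shift-congʳ ∼-refl          = ∼-refl
  shift-congʳ (∼-sym h)       = ∼-sym (shift-congʳ h)
  shift-congʳ (∼-trans h h′)  = ∼-trans (shift-congʳ h) (shift-congʳ h′)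
  shift-congʳ (∼-cons e f h)  = ∼-cons (R.*-congˡ e) (E.∙-congˡ f) (shift-congʳ h)
  shift-congʳ ∼-swap          = ∼-swap
  shift-congʳ ∼-merge         = ∼-trans ∼-merge (∼-cons (R.sym (R.distribˡ _ _ _)) E.refl ∼-refl)
  shift-congʳ ∼-drop          = ∼-trans (∼-cons (R.zeroʳ _) E.refl ∼-refl) ∼-drop

  shift-congˡ : ∀ {a b x y} p → a ≈ b → x E.≈ y → shift a x p ∼ shift b y p
  shift-congˡ []      e f = ∼-refl
  shift-congˡ (_ ∷ p) e f = ∼-cons (R.*-congʳ e) (E.∙-congʳ f) (shift-congˡ p e f)

  shift-zero : ∀ x p → shift 0# x p ∼ []
  shift-zero x []      = ∼-refl
  shift-zero x (_ ∷ p) =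
    ∼-trans (∼-cons (R.zeroˡ _) E.refl ∼-refl) (∼-trans ∼-drop (shift-zero x p))

  shift-+ : ∀ a b x p → shift a x p ++ shift b x p ∼ shift (a + b) x p
  shift-+ a b x []            = ∼-refl
  shift-+ a b x ((c , y) ∷ p) = begin
    (a * c , x ∙ y) ∷ shift a x p ++ (b * c , x ∙ y) ∷ shift b x p  ≈⟨ ∼-prep _ (++-shift _ (shift a x p) _) ⟩
    (a * c , x ∙ y) ∷ (b * c , x ∙ y) ∷ shift a x p ++ shift b x p  ≈⟨ ∼-merge ⟩
    (a * c + b * c , x ∙ y) ∷ shift a x p ++ shift b x p            ≈⟨ ∼-cons (R.sym (R.distribʳ c a b)) E.refl (shift-+ a b x p) ⟩
    ((a + b) * c , x ∙ y) ∷ shift (a + b) x p                       ∎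

  shift-shift : ∀ a x b y p → shift (a * b) (x ∙ y) p ∼ shift a x (shift b y p)
  shift-shift a x b y []      = ∼-refl
  shift-shift a x b y (_ ∷ p) = ∼-cons (R.*-assoc _ _ _) (E.assoc _ _ _) (shift-shift a x b y p)

  shift-one : ∀ p → shift 1# ε p ∼ p
  shift-one []      = ∼-refl
  shift-one (_ ∷ p) = ∼-cons (R.*-identityˡ _) (E.identityˡ _) (shift-one p)

  ⊛-congʳ : ∀ p {q t} → q ∼ t → p ⊛ q ∼ p ⊛ t
  ⊛-congʳ []      h = ∼-refl
  ⊛-congʳ (_ ∷ p) h = ++-cong (shift-congʳ h) (⊛-congʳ p h)

  ⊛-congˡ : ∀ t {p q} → p ∼ q → p ⊛ t ∼ q ⊛ t
  ⊛-congˡ t ∼-refl         = ∼-refl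
  ⊛-congˡ t (∼-sym h)      = ∼-sym (⊛-congˡ t h)
  ⊛-congˡ t (∼-trans h h′) = ∼-trans (⊛-congˡ t h) (⊛-congˡ t h′)
  ⊛-congˡ t (∼-cons e f h) = ++-cong (shift-congˡ t e f) (⊛-congˡ t h)
  ⊛-congˡ t (∼-swap {a , x} {b , y} {p}) = x∙yz≈y∙xz (shift a x t) (shift b y t) (p ⊛ t)
  ⊛-congˡ t (∼-merge {a} {b} {x} {p}) = begin
    shift a x t ++ (shift b x t ++ p ⊛ t)  ≡⟨ ++-assoc (shift a x t) (shift b x t) (p ⊛ t) ⟨
    (shift a x t ++ shift b x t) ++ p ⊛ t  ≈⟨ ++-congʳ (p ⊛ t) (shift-+ a b x t) ⟩
    shift (a + b) x t ++ p ⊛ t             ∎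
  ⊛-congˡ t (∼-drop {x} {p}) = ++-congʳ (p ⊛ t) (shift-zero x t)

  ⊛-distribʳ : ∀ t p q → (p ++ q) ⊛ t ∼ p ⊛ t ++ q ⊛ t
  ⊛-distribʳ t []            q = ∼-refl
  ⊛-distribʳ t ((a , x) ∷ p) q = begin
    shift a x t ++ (p ++ q) ⊛ t        ≈⟨ ++-congˡ (shift a x t) (⊛-distribʳ t p q) ⟩
    shift a x t ++ (p ⊛ t ++ q ⊛ t)    ≡⟨ ++-assoc (shift a x t) (p ⊛ t) (q ⊛ t) ⟨
    (shift a x t ++ p ⊛ t) ++ q ⊛ t    ∎

  ⊛-zeroʳ : ∀ p → p ⊛ [] ∼ []
  ⊛-zeroʳ []      = ∼-refl
  ⊛-zeroʳ (_ ∷ p) = ⊛-zeroʳ p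

  ⊛-cons : ∀ p b y q → p ⊛ ((b , y) ∷ q) ∼ shift b y p ++ p ⊛ q
  ⊛-cons []            b y q = ∼-refl
  ⊛-cons ((a , x) ∷ p) b y q = ∼-cons (R.*-comm a b) (E.comm x y) (begin
    shift a x q ++ p ⊛ ((b , y) ∷ q)    ≈⟨ ++-congˡ (shift a x q) (⊛-cons p b y q) ⟩
    shift a x q ++ (shift b y p ++ p ⊛ q)  ≈⟨ x∙yz≈y∙xz (shift a x q) (shift b y p) (p ⊛ q) ⟩
    shift b y p ++ (shift a x q ++ p ⊛ q)  ∎)

  ⊛-comm : ∀ p q → p ⊛ q ∼ q ⊛ p
  ⊛-comm []            q = ∼-sym (⊛-zeroʳ q)
  ⊛-comm ((a , x) ∷ p) q = begin
    shift a x q ++ p ⊛ q   ≈⟨ ++-congˡ (shift a x q) (⊛-comm p q) ⟩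
    shift a x q ++ q ⊛ p   ≈⟨ ⊛-cons q a x p ⟨
    q ⊛ ((a , x) ∷ p)      ∎

  shift-⊛ : ∀ a x p q → shift a x p ⊛ q ∼ shift a x (p ⊛ q)
  shift-⊛ a x []            q = ∼-refl
  shift-⊛ a x ((b , y) ∷ p) q = begin
    shift (a * b) (x ∙ y) q ++ shift a x p ⊛ q        ≈⟨ ++-cong (shift-shift a x b y q) (shift-⊛ a x p q) ⟩
    shift a x (shift b y q) ++ shift a x (p ⊛ q)      ≡⟨ map-++ _ (shift b y q) (p ⊛ q) ⟨
    shift a x (shift b y q ++ p ⊛ q)                  ∎

  ⊛-assoc : ∀ p q t → (p ⊛ q) ⊛ t ∼ p ⊛ (q ⊛ t)
  ⊛-assoc []            q t = ∼-refl
  ⊛-assoc ((a , x) ∷ p) q t = begin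
    (shift a x q ++ p ⊛ q) ⊛ t        ≈⟨ ⊛-distribʳ t (shift a x q) (p ⊛ q) ⟩
    shift a x q ⊛ t ++ (p ⊛ q) ⊛ t    ≈⟨ ++-cong (shift-⊛ a x q t) (⊛-assoc p q t) ⟩
    shift a x (q ⊛ t) ++ p ⊛ (q ⊛ t)  ∎

  ⊛-identityˡ : ∀ p → one ⊛ p ∼ p
  ⊛-identityˡ p = ∼-trans (++-identityʳ (shift 1# ε p)) (shift-one p)

  abstract
    isCommutativeRing : IsCommutativeRing _∼_ _++_ _⊛_ negate [] one
    isCommutativeRing = record
      { isRing = record
        { +-isAbelianGroup = record
          { isGroup = record
            { isMonoid = IsCommutativeMonoid.isMonoid ++-isCommutativeMonoid
            ; inverse  = negate-inverseˡ , negate-inverseʳ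
            ; ⁻¹-cong  = negate-cong
            }
          ; comm = ++-comm
          }
        ; *-cong     = λ {p} {q} {t} {u} h h′ → ∼-trans (⊛-congˡ t h) (⊛-congʳ q h′)
        ; *-assoc    = ⊛-assoc
        ; *-identity = ⊛-identityˡ , λ p → ∼-trans (⊛-comm p one) (⊛-identityˡ p)
        ; distrib    =
            (λ t p q → ∼-trans (⊛-comm t (p ++ q)) (∼-trans (⊛-distribʳ t p q)
                         (++-cong (⊛-comm p t) (⊛-comm q t))))
          , ⊛-distribʳ
        }
      ; *-comm = ⊛-comm
      }

  monoidAlgebra : CommutativeRing (r ⊔ e) (r ⊔ ℓr ⊔ e ⊔ ℓe)
  monoidAlgebra = record { isCommutativeRing = isCommutativeRing }

open MonoidAlgebra public using (monoidAlgebra)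

-- Exponent vectors: u stands for the monomial X₁^u₁ ⋯ Xₙ^uₙ.
monomials : ℕ → CommutativeMonoid 0ℓ 0ℓ
monomials n = record
  { Carrier = Vec ℕ n
  ; _≈_ = _≡_
  ; _∙_ = zipWith ℕ._+_
  ; ε = replicate n 0
  ; isCommutativeMonoid = record
    { isMonoid = record
      { isSemigroup = record
        { isMagma = record
          { isEquivalence = ≡.isEquivalence
          ; ∙-cong = ≡.cong₂ (zipWith ℕ._+_)
          }
        ; assoc = Vec.zipWith-assoc ℕ.+-assoc
        }
      ; identity = Vec.zipWith-identityˡ ℕ.+-identityˡ , Vec.zipWith-identityʳ ℕ.+-identityʳ
      }
    ; comm = Vec.zipWith-comm ℕ.+-comm
    }
  }

polynomialRing : {r ℓr : Level} → CommutativeRing r ℓr → ℕ → CommutativeRing r (r ⊔ ℓr)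
polynomialRing R n = monoidAlgebra R (monomials n)

record CommutativeAlgebra {r ℓr : Level} (R : CommutativeRing r ℓr) (b ℓb : Level)
  : Set (r ⊔ ℓr ⊔ suc (b ⊔ ℓb)) where
  field
    ring                : CommutativeRing b ℓb
    structureMap        : Carrier R → Carrier ring
    isRingHomomorphism  : IsRingHomomorphism
                            (CommutativeRing.rawRing R) (CommutativeRing.rawRing ring) structureMap

module _ {r ℓr b ℓb : Level} {R : CommutativeRing r ℓr} (B : CommutativeAlgebra R b ℓb) where

  open CommutativeAlgebra B renaming (structureMap to φ)
  private
    module R = CommutativeRing R
    module B = CommutativeRing ring
    module φ = IsRingHomomorphism isRingHomomorphism
  open B using (_≈_; _+_; _*_; 0#)
  open Exp B.semiring using (_^_)
  open RawMonoidDefs B.*-rawMonoid using () renaming (sum to product)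

  evaluate : {n : ℕ} → Vector B.Carrier n → Carrier (polynomialRing R n) → B.Carrier
  evaluate x []            = 0#
  evaluate x ((a , u) ∷ p) = φ a * product (λ i → x i ^ lookup u i) + evaluate x p

  IsGeneratedAsAlgebraBy : {n : ℕ} → Vector B.Carrier n → Set (r ⊔ b ⊔ ℓb)
  IsGeneratedAsAlgebraBy x = ∀ y → ∃ λ p → evaluate x p ≈ y

  IsOfFiniteType : Set (r ⊔ b ⊔ ℓb)
  IsOfFiniteType = ∃ λ n → Σ (Vector B.Carrier n) IsGeneratedAsAlgebraBy

  -- B ≅ R[X₁,…,Xₙ]/(g₁,…,gₖ): the evaluation map at some x₁,…,xₙ is
  -- surjective and its kernel is the ideal generated by g₁,…,gₖ.
  IsOfFinitePresentation : Set (r ⊔ ℓr ⊔ b ⊔ ℓb)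
  IsOfFinitePresentation =
    ∃ λ n → Σ (Vector B.Carrier n) λ x → IsGeneratedAsAlgebraBy x ×
    ∃ λ k → Σ (Vector (Carrier (polynomialRing R n)) k) λ g →
      (∀ j → evaluate x (g j) ≈ 0#) ×
      (∀ p → evaluate x p ≈ 0# →
         ∃ λ h → CommutativeRing._≈_ (polynomialRing R n)
                   (linearCombination (⟨module⟩ {R = polynomialRing R n}) h g) p)

  private
    abstract
      restrictScalars-isLeftModule : {m ℓm : Level} (M : Module ring m ℓm) → let open Module M in
        IsLeftModule R.ring _≈ᴹ_ _+ᴹ_ 0ᴹ -ᴹ_ (λ a → φ a *ₗ_)
      restrictScalars-isLeftModule M = record
        { isLeftSemimodule = record
          { +ᴹ-isCommutativeMonoid = IsAbelianGroup.isCommutativeMonoid +ᴹ-isAbelianGroup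
          ; isPreleftSemimodule = record
            { *ₗ-cong      = λ e h → *ₗ-cong (φ.⟦⟧-cong e) h
            ; *ₗ-zeroˡ     = λ x → ≈ᴹ-trans (*ₗ-congʳ φ.0#-homo) (*ₗ-zeroˡ x)
            ; *ₗ-distribʳ  = λ x a b → ≈ᴹ-trans (*ₗ-congʳ (φ.+-homo a b)) (*ₗ-distribʳ x (φ a) (φ b))
            ; *ₗ-identityˡ = λ x → ≈ᴹ-trans (*ₗ-congʳ φ.1#-homo) (*ₗ-identityˡ x)
            ; *ₗ-assoc     = λ a b x → ≈ᴹ-trans (*ₗ-congʳ (φ.*-homo a b)) (*ₗ-assoc (φ a) (φ b) x)
            ; *ₗ-zeroʳ     = λ a → *ₗ-zeroʳ (φ a)
            ; *ₗ-distribˡ  = λ a → *ₗ-distribˡ (φ a)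
            }
          }
        ; -ᴹ‿cong    = -ᴹ‿cong
        ; -ᴹ‿inverse = -ᴹ‿inverse
        }
        where open Module M

  restrictScalars : {m ℓm : Level} → Module ring m ℓm → Module R m ℓm
  restrictScalars M = record
    { Carrierᴹ = Carrierᴹ
    ; _≈ᴹ_ = _≈ᴹ_
    ; _+ᴹ_ = _+ᴹ_
    ; _*ₗ_ = λ a x → φ a *ₗ x
    ; _*ᵣ_ = λ x a → φ a *ₗ x
    ; 0ᴹ = 0ᴹ
    ; -ᴹ_ = -ᴹ_
    ; isModule = IsModuleFromLeft.isModule {commutativeRing = R}
        (record { isLeftModule = restrictScalars-isLeftModule M })
    }
    where open Module M

  algebraModule : Module R b ℓb
  algebraModule = restrictScalars ⟨module⟩

-- x /^ n stands for the fraction x / sⁿ, where s is the element being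
-- inverted.
infix 9 _/^_

record Fraction {x : Level} (X : Set x) : Set x where
  constructor _/^_
  field
    numerator : X
    exponent  : ℕ

open Fraction public

module Localization {r ℓr : Level} (R : CommutativeRing r ℓr) (s : Carrier R) where

  private
    module R = CommutativeRing R
  open R using (_≈_; _+_; _*_; -_; 0#; 1#)
  open Exp R.semiring using (_^_; ^-homo-*)

  _+ᶠ_ : Fraction R.Carrier → Fraction R.Carrier → Fraction R.Carrier
  (a /^ n) +ᶠ (b /^ k) = (s ^ k * a + s ^ n * b) /^ (n ℕ.+ k)

  0ᶠ : Fraction R.Carrier
  0ᶠ = 0# /^ 0

  1ᶠ : Fraction R.Carrier
  1ᶠ = 1# /^ 0

  module _ {m ℓm : Level} (M : Module R m ℓm) where

    open Module M

    infix  4 _≈ᶠᴹ_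
    infixl 6 _+ᶠᴹ_
    infixr 7 _*ᶠᴹ_
    infixr 8 -ᶠᴹ_

    -- A record rather than an abbreviation for an existential quantifier, so
    -- that the two fractions can be inferred from their equality.
    record _≈ᶠᴹ_ (u v : Fraction Carrierᴹ) : Set ℓm where
      constructor cross
      field
        power : ℕ
        equality : s ^ power *ₗ s ^ exponent v *ₗ numerator u
                   ≈ᴹ s ^ power *ₗ s ^ exponent u *ₗ numerator v

    _+ᶠᴹ_ : Fraction Carrierᴹ → Fraction Carrierᴹ → Fraction Carrierᴹ
    x /^ n +ᶠᴹ y /^ k = (s ^ k *ₗ x +ᴹ s ^ n *ₗ y) /^ (n ℕ.+ k)

    0ᶠᴹ : Fraction Carrierᴹ
    0ᶠᴹ = 0ᴹ /^ 0

    -ᶠᴹ_ : Fraction Carrierᴹ → Fraction Carrierᴹ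
    -ᶠᴹ (x /^ n) = (-ᴹ x) /^ n

    _*ᶠᴹ_ : Fraction R.Carrier → Fraction Carrierᴹ → Fraction Carrierᴹ
    (a /^ n) *ᶠᴹ (x /^ k) = (a *ₗ x) /^ (n ℕ.+ k)

    private
      open ≈-Reasoning ≈ᴹ-setoid
      open MonoidSolver R.*-commutativeMonoid using (solve; _⊕_; _⊜_)

      act-^+ : ∀ n k x → s ^ (n ℕ.+ k) *ₗ x ≈ᴹ s ^ n *ₗ s ^ k *ₗ x
      act-^+ n k x = ≈ᴹ-trans (*ₗ-congʳ (^-homo-* s n k)) (*ₗ-assoc _ _ x)

      act-≡ : ∀ {n k} x → n ≡ k → s ^ n *ₗ x ≈ᴹ s ^ k *ₗ x
      act-≡ x ≡.refl = ≈ᴹ-refl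

      *ₗ-neg : ∀ a x → a *ₗ (-ᴹ x) ≈ᴹ -ᴹ (a *ₗ x)
      *ₗ-neg a x = ModuleProperties.inverseˡ-uniqueᴹ M (a *ₗ (-ᴹ x)) (a *ₗ x) (begin
        a *ₗ (-ᴹ x) +ᴹ a *ₗ x  ≈⟨ *ₗ-distribˡ a (-ᴹ x) x ⟨
        a *ₗ (-ᴹ x +ᴹ x)       ≈⟨ *ₗ-congˡ (-ᴹ‿inverseˡ x) ⟩
        a *ₗ 0ᴹ                ≈⟨ *ₗ-zeroʳ a ⟩
        0ᴹ                     ∎)

      flatten₂ : ∀ a b x → a *ₗ b *ₗ x ≈ᴹ (a * b) *ₗ x
      flatten₂ a b x = ≈ᴹ-sym (*ₗ-assoc a b x)

      flatten₃ : ∀ a b c x → a *ₗ b *ₗ c *ₗ x ≈ᴹ (a * (b * c)) *ₗ x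
      flatten₃ a b c x = ≈ᴹ-trans (*ₗ-congˡ (flatten₂ b c x)) (flatten₂ a (b * c) x)

    ≈ᶠᴹ-equal : ∀ {x y n k} → x ≈ᴹ y → n ≡ k → x /^ n ≈ᶠᴹ y /^ k
    ≈ᶠᴹ-equal {n = n} h ≡.refl = cross 0 (*ₗ-congˡ (*ₗ-congˡ h))

    ≈ᶠᴹ-expand : ∀ {x y n k} l → y ≈ᴹ s ^ l *ₗ x → k ≡ n ℕ.+ l → x /^ n ≈ᶠᴹ y /^ k
    ≈ᶠᴹ-expand {x} {y} {n} l h ≡.refl = cross 0 (*ₗ-congˡ (begin
      s ^ (n ℕ.+ l) *ₗ x    ≈⟨ act-^+ n l x ⟩
      s ^ n *ₗ s ^ l *ₗ x   ≈⟨ *ₗ-congˡ h ⟨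
      s ^ n *ₗ y            ∎))

    ≈ᶠᴹ-refl : ∀ {u} → u ≈ᶠᴹ u
    ≈ᶠᴹ-refl = cross 0 ≈ᴹ-refl

    ≈ᶠᴹ-sym : ∀ {u v} → u ≈ᶠᴹ v → v ≈ᶠᴹ u
    ≈ᶠᴹ-sym (cross j h) = cross j (≈ᴹ-sym h)

    ≈ᶠᴹ-trans : ∀ {u v w} → u ≈ᶠᴹ v → v ≈ᶠᴹ w → u ≈ᶠᴹ w
    ≈ᶠᴹ-trans {x /^ n} {y /^ k} {z /^ l} (cross j h) (cross j′ h′) = cross ((j ℕ.+ j′) ℕ.+ k) (begin
      s ^ ((j ℕ.+ j′) ℕ.+ k) *ₗ s ^ l *ₗ x              ≈⟨ regroup l x ⟩
      (s ^ j′ * s ^ l) *ₗ s ^ j *ₗ s ^ k *ₗ x           ≈⟨ *ₗ-congˡ h ⟩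
      (s ^ j′ * s ^ l) *ₗ s ^ j *ₗ s ^ n *ₗ y           ≈⟨ exchange ⟩
      (s ^ j * s ^ n) *ₗ s ^ j′ *ₗ s ^ l *ₗ y           ≈⟨ *ₗ-congˡ h′ ⟩
      (s ^ j * s ^ n) *ₗ s ^ j′ *ₗ s ^ k *ₗ z           ≈⟨ regroup′ ⟩
      s ^ ((j ℕ.+ j′) ℕ.+ k) *ₗ s ^ n *ₗ z              ∎)
      where
      power : s ^ ((j ℕ.+ j′) ℕ.+ k) ≈ (s ^ j * s ^ j′) * s ^ k
      power = R.trans (^-homo-* s (j ℕ.+ j′) k) (R.*-congʳ (^-homo-* s j j′))

      regroup : ∀ l x → s ^ ((j ℕ.+ j′) ℕ.+ k) *ₗ s ^ l *ₗ x
                        ≈ᴹ (s ^ j′ * s ^ l) *ₗ s ^ j *ₗ s ^ k *ₗ x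
      regroup l x = begin
        s ^ ((j ℕ.+ j′) ℕ.+ k) *ₗ s ^ l *ₗ x         ≈⟨ *ₗ-congʳ power ⟩
        ((s ^ j * s ^ j′) * s ^ k) *ₗ s ^ l *ₗ x     ≈⟨ flatten₂ _ _ x ⟩
        (((s ^ j * s ^ j′) * s ^ k) * s ^ l) *ₗ x    ≈⟨ *ₗ-congʳ (solve 4 (λ a b c d →
                                                          ((a ⊕ b) ⊕ c) ⊕ d ⊜ (b ⊕ d) ⊕ (a ⊕ c))
                                                          R.refl (s ^ j) (s ^ j′) (s ^ k) (s ^ l)) ⟩
        ((s ^ j′ * s ^ l) * (s ^ j * s ^ k)) *ₗ x    ≈⟨ flatten₃ _ _ _ x ⟨
        (s ^ j′ * s ^ l) *ₗ s ^ j *ₗ s ^ k *ₗ x      ∎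

      exchange : (s ^ j′ * s ^ l) *ₗ s ^ j *ₗ s ^ n *ₗ y ≈ᴹ (s ^ j * s ^ n) *ₗ s ^ j′ *ₗ s ^ l *ₗ y
      exchange = begin
        (s ^ j′ * s ^ l) *ₗ s ^ j *ₗ s ^ n *ₗ y      ≈⟨ *ₗ-congˡ (flatten₂ _ _ y) ⟩
        (s ^ j′ * s ^ l) *ₗ (s ^ j * s ^ n) *ₗ y     ≈⟨ *ₗ-comm _ _ y ⟩
        (s ^ j * s ^ n) *ₗ (s ^ j′ * s ^ l) *ₗ y     ≈⟨ *ₗ-congˡ (flatten₂ _ _ y) ⟨
        (s ^ j * s ^ n) *ₗ s ^ j′ *ₗ s ^ l *ₗ y      ∎

      regroup′ : (s ^ j * s ^ n) *ₗ s ^ j′ *ₗ s ^ k *ₗ z ≈ᴹ s ^ ((j ℕ.+ j′) ℕ.+ k) *ₗ s ^ n *ₗ z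
      regroup′ = begin
        (s ^ j * s ^ n) *ₗ s ^ j′ *ₗ s ^ k *ₗ z      ≈⟨ flatten₃ _ _ _ z ⟩
        ((s ^ j * s ^ n) * (s ^ j′ * s ^ k)) *ₗ z    ≈⟨ *ₗ-congʳ (solve 4 (λ a b c d →
                                                          ((a ⊕ b) ⊕ c) ⊕ d ⊜ (a ⊕ d) ⊕ (b ⊕ c))
                                                          R.refl (s ^ j) (s ^ j′) (s ^ k) (s ^ n)) ⟨
        (((s ^ j * s ^ j′) * s ^ k) * s ^ n) *ₗ z    ≈⟨ flatten₂ _ _ z ⟨
        ((s ^ j * s ^ j′) * s ^ k) *ₗ s ^ n *ₗ z     ≈⟨ *ₗ-congʳ power ⟨
        s ^ ((j ℕ.+ j′) ℕ.+ k) *ₗ s ^ n *ₗ z         ∎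

    ≈ᶠᴹ-isEquivalence : IsEquivalence _≈ᶠᴹ_
    ≈ᶠᴹ-isEquivalence = record { refl = ≈ᶠᴹ-refl ; sym = ≈ᶠᴹ-sym ; trans = ≈ᶠᴹ-trans }

    +ᶠᴹ-comm : ∀ u v → u +ᶠᴹ v ≈ᶠᴹ v +ᶠᴹ u
    +ᶠᴹ-comm (x /^ n) (y /^ k) = ≈ᶠᴹ-equal (+ᴹ-comm _ _) (ℕ.+-comm n k)

    +ᶠᴹ-congʳ : ∀ {u v} w → u ≈ᶠᴹ v → u +ᶠᴹ w ≈ᶠᴹ v +ᶠᴹ w
    +ᶠᴹ-congʳ {x /^ n} {y /^ k} (z /^ l) (cross j h) = cross j (begin
      s ^ j *ₗ s ^ (k ℕ.+ l) *ₗ (s ^ l *ₗ x +ᴹ s ^ n *ₗ z)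
        ≈⟨ distribute (s ^ j) (s ^ (k ℕ.+ l)) _ _ ⟩
      s ^ j *ₗ s ^ (k ℕ.+ l) *ₗ s ^ l *ₗ x +ᴹ s ^ j *ₗ s ^ (k ℕ.+ l) *ₗ s ^ n *ₗ z
        ≈⟨ +ᴹ-cong first second ⟩
      s ^ j *ₗ s ^ (n ℕ.+ l) *ₗ s ^ l *ₗ y +ᴹ s ^ j *ₗ s ^ (n ℕ.+ l) *ₗ s ^ k *ₗ z
        ≈⟨ distribute (s ^ j) (s ^ (n ℕ.+ l)) _ _ ⟨
      s ^ j *ₗ s ^ (n ℕ.+ l) *ₗ (s ^ l *ₗ y +ᴹ s ^ k *ₗ z) ∎)
      where
      distribute : ∀ a b x y → a *ₗ b *ₗ (x +ᴹ y) ≈ᴹ a *ₗ b *ₗ x +ᴹ a *ₗ b *ₗ y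
      distribute a b x y = ≈ᴹ-trans (*ₗ-congˡ (*ₗ-distribˡ b x y)) (*ₗ-distribˡ a _ _)

      regroup : ∀ k x → s ^ j *ₗ s ^ (k ℕ.+ l) *ₗ s ^ l *ₗ x
                        ≈ᴹ (s ^ l * s ^ l) *ₗ s ^ j *ₗ s ^ k *ₗ x
      regroup k x = begin
        s ^ j *ₗ s ^ (k ℕ.+ l) *ₗ s ^ l *ₗ x         ≈⟨ flatten₃ _ _ _ x ⟩
        (s ^ j * (s ^ (k ℕ.+ l) * s ^ l)) *ₗ x       ≈⟨ *ₗ-congʳ (R.*-congˡ (R.*-congʳ (^-homo-* s k l))) ⟩
        (s ^ j * ((s ^ k * s ^ l) * s ^ l)) *ₗ x     ≈⟨ *ₗ-congʳ (solve 3 (λ a b c →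
                                                          a ⊕ ((b ⊕ c) ⊕ c) ⊜ (c ⊕ c) ⊕ (a ⊕ b))
                                                          R.refl (s ^ j) (s ^ k) (s ^ l)) ⟩
        ((s ^ l * s ^ l) * (s ^ j * s ^ k)) *ₗ x     ≈⟨ flatten₃ _ _ _ x ⟨
        (s ^ l * s ^ l) *ₗ s ^ j *ₗ s ^ k *ₗ x       ∎

      first : s ^ j *ₗ s ^ (k ℕ.+ l) *ₗ s ^ l *ₗ x ≈ᴹ s ^ j *ₗ s ^ (n ℕ.+ l) *ₗ s ^ l *ₗ y
      first = ≈ᴹ-trans (regroup k x) (≈ᴹ-trans (*ₗ-congˡ h) (≈ᴹ-sym (regroup n y)))

      second : s ^ j *ₗ s ^ (k ℕ.+ l) *ₗ s ^ n *ₗ z ≈ᴹ s ^ j *ₗ s ^ (n ℕ.+ l) *ₗ s ^ k *ₗ z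
      second = *ₗ-congˡ (begin
        s ^ (k ℕ.+ l) *ₗ s ^ n *ₗ z       ≈⟨ act-^+ k l _ ⟩
        s ^ k *ₗ s ^ l *ₗ s ^ n *ₗ z      ≈⟨ *ₗ-comm _ _ _ ⟩
        s ^ l *ₗ s ^ k *ₗ s ^ n *ₗ z      ≈⟨ *ₗ-congˡ (*ₗ-comm _ _ _) ⟩
        s ^ l *ₗ s ^ n *ₗ s ^ k *ₗ z      ≈⟨ *ₗ-comm _ _ _ ⟩
        s ^ n *ₗ s ^ l *ₗ s ^ k *ₗ z      ≈⟨ act-^+ n l _ ⟨
        s ^ (n ℕ.+ l) *ₗ s ^ k *ₗ z       ∎)

    +ᶠᴹ-cong : ∀ {u u′ v v′} → u ≈ᶠᴹ u′ → v ≈ᶠᴹ v′ → u +ᶠᴹ v ≈ᶠᴹ u′ +ᶠᴹ v′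
    +ᶠᴹ-cong {u} {u′} {v} {v′} h h′ =
      ≈ᶠᴹ-trans (+ᶠᴹ-congʳ v h) (≈ᶠᴹ-trans (+ᶠᴹ-comm u′ v)
        (≈ᶠᴹ-trans (+ᶠᴹ-congʳ u′ h′) (+ᶠᴹ-comm v′ u′)))

    +ᶠᴹ-assoc : ∀ u v w → (u +ᶠᴹ v) +ᶠᴹ w ≈ᶠᴹ u +ᶠᴹ (v +ᶠᴹ w)
    +ᶠᴹ-assoc (x /^ n) (y /^ k) (z /^ l) = ≈ᶠᴹ-equal (begin
      s ^ l *ₗ (s ^ k *ₗ x +ᴹ s ^ n *ₗ y) +ᴹ s ^ (n ℕ.+ k) *ₗ z
        ≈⟨ +ᴹ-cong (*ₗ-distribˡ _ _ _) (act-^+ n k z) ⟩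
      (s ^ l *ₗ s ^ k *ₗ x +ᴹ s ^ l *ₗ s ^ n *ₗ y) +ᴹ s ^ n *ₗ s ^ k *ₗ z
        ≈⟨ +ᴹ-assoc _ _ _ ⟩
      s ^ l *ₗ s ^ k *ₗ x +ᴹ (s ^ l *ₗ s ^ n *ₗ y +ᴹ s ^ n *ₗ s ^ k *ₗ z)
        ≈⟨ +ᴹ-cong (*ₗ-comm _ _ _) (+ᴹ-congʳ (*ₗ-comm _ _ _)) ⟩
      s ^ k *ₗ s ^ l *ₗ x +ᴹ (s ^ n *ₗ s ^ l *ₗ y +ᴹ s ^ n *ₗ s ^ k *ₗ z)
        ≈⟨ +ᴹ-cong (act-^+ k l x) (*ₗ-distribˡ _ _ _) ⟨
      s ^ (k ℕ.+ l) *ₗ x +ᴹ s ^ n *ₗ (s ^ l *ₗ y +ᴹ s ^ k *ₗ z) ∎)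
      (ℕ.+-assoc n k l)

    +ᶠᴹ-identityˡ : ∀ u → 0ᶠᴹ +ᶠᴹ u ≈ᶠᴹ u
    +ᶠᴹ-identityˡ (x /^ n) = ≈ᶠᴹ-equal (begin
      s ^ n *ₗ 0ᴹ +ᴹ 1# *ₗ x  ≈⟨ +ᴹ-cong (*ₗ-zeroʳ _) (*ₗ-identityˡ x) ⟩
      0ᴹ +ᴹ x                 ≈⟨ +ᴹ-identityˡ x ⟩
      x                       ∎) ≡.refl

    -ᶠᴹ-cong : ∀ {u v} → u ≈ᶠᴹ v → -ᶠᴹ u ≈ᶠᴹ -ᶠᴹ v
    -ᶠᴹ-cong {x /^ n} {y /^ k} (cross j h) =
      cross j (≈ᴹ-trans (pull k x) (≈ᴹ-trans (-ᴹ‿cong h) (≈ᴹ-sym (pull n y))))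
      where
      pull : ∀ k x → s ^ j *ₗ s ^ k *ₗ (-ᴹ x) ≈ᴹ -ᴹ (s ^ j *ₗ s ^ k *ₗ x)
      pull k x = ≈ᴹ-trans (*ₗ-congˡ (*ₗ-neg _ x)) (*ₗ-neg _ _)

    -ᶠᴹ-inverseˡ : ∀ u → -ᶠᴹ u +ᶠᴹ u ≈ᶠᴹ 0ᶠᴹ
    -ᶠᴹ-inverseˡ (x /^ n) = ≈ᶠᴹ-sym (≈ᶠᴹ-expand (n ℕ.+ n) (begin
      s ^ n *ₗ (-ᴹ x) +ᴹ s ^ n *ₗ x   ≈⟨ *ₗ-distribˡ _ _ _ ⟨
      s ^ n *ₗ (-ᴹ x +ᴹ x)            ≈⟨ *ₗ-congˡ (proj₁ -ᴹ‿inverse x) ⟩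
      s ^ n *ₗ 0ᴹ                     ≈⟨ *ₗ-zeroʳ _ ⟩
      0ᴹ                              ≈⟨ *ₗ-zeroʳ _ ⟨
      s ^ (n ℕ.+ n) *ₗ 0ᴹ             ∎) ≡.refl)

    +ᶠᴹ-isAbelianGroup : IsAbelianGroup _≈ᶠᴹ_ _+ᶠᴹ_ 0ᶠᴹ -ᶠᴹ_
    +ᶠᴹ-isAbelianGroup = record
      { isGroup = record
        { isMonoid = record
          { isSemigroup = record
            { isMagma = record { isEquivalence = ≈ᶠᴹ-isEquivalence ; ∙-cong = +ᶠᴹ-cong }
            ; assoc   = +ᶠᴹ-assoc
            }
          ; identity = +ᶠᴹ-identityˡ , λ u → ≈ᶠᴹ-trans (+ᶠᴹ-comm u 0ᶠᴹ) (+ᶠᴹ-identityˡ u)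
          }
        ; inverse = -ᶠᴹ-inverseˡ , λ u → ≈ᶠᴹ-trans (+ᶠᴹ-comm u (-ᶠᴹ u)) (-ᶠᴹ-inverseˡ u)
        ; ⁻¹-cong = -ᶠᴹ-cong
        }
      ; comm = +ᶠᴹ-comm
      }

    *ᶠᴹ-zeroˡ : ∀ u → 0ᶠ *ᶠᴹ u ≈ᶠᴹ 0ᶠᴹ
    *ᶠᴹ-zeroˡ (x /^ n) =
      ≈ᶠᴹ-sym (≈ᶠᴹ-expand n (≈ᴹ-trans (*ₗ-zeroˡ x) (≈ᴹ-sym (*ₗ-zeroʳ _))) ≡.refl)

    *ᶠᴹ-zeroʳ : ∀ q → q *ᶠᴹ 0ᶠᴹ ≈ᶠᴹ 0ᶠᴹ
    *ᶠᴹ-zeroʳ (a /^ n) =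
      ≈ᶠᴹ-sym (≈ᶠᴹ-expand n (≈ᴹ-trans (*ₗ-zeroʳ a) (≈ᴹ-sym (*ₗ-zeroʳ _))) (ℕ.+-identityʳ n))

    *ᶠᴹ-identityˡ : ∀ u → 1ᶠ *ᶠᴹ u ≈ᶠᴹ u
    *ᶠᴹ-identityˡ (x /^ n) = ≈ᶠᴹ-equal (*ₗ-identityˡ x) ≡.refl

    *ᶠᴹ-distribʳ : ∀ u p q → (p +ᶠ q) *ᶠᴹ u ≈ᶠᴹ p *ᶠᴹ u +ᶠᴹ q *ᶠᴹ u
    *ᶠᴹ-distribʳ (x /^ l) (a /^ n) (b /^ k) = ≈ᶠᴹ-expand l (begin
      s ^ (k ℕ.+ l) *ₗ a *ₗ x +ᴹ s ^ (n ℕ.+ l) *ₗ b *ₗ x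
        ≈⟨ +ᴹ-cong (pull k a) (pull n b) ⟩
      s ^ l *ₗ (s ^ k * a) *ₗ x +ᴹ s ^ l *ₗ (s ^ n * b) *ₗ x
        ≈⟨ *ₗ-distribˡ _ _ _ ⟨
      s ^ l *ₗ ((s ^ k * a) *ₗ x +ᴹ (s ^ n * b) *ₗ x)
        ≈⟨ *ₗ-congˡ (*ₗ-distribʳ _ _ _) ⟨
      s ^ l *ₗ (s ^ k * a + s ^ n * b) *ₗ x ∎)
      (solveℕ n k l)
      where
      pull : ∀ k a → s ^ (k ℕ.+ l) *ₗ a *ₗ x ≈ᴹ s ^ l *ₗ (s ^ k * a) *ₗ x
      pull k a = begin
        s ^ (k ℕ.+ l) *ₗ a *ₗ x      ≈⟨ act-^+ k l _ ⟩
        s ^ k *ₗ s ^ l *ₗ a *ₗ x     ≈⟨ *ₗ-comm _ _ _ ⟩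
        s ^ l *ₗ s ^ k *ₗ a *ₗ x     ≈⟨ *ₗ-congˡ (flatten₂ _ _ x) ⟩
        s ^ l *ₗ (s ^ k * a) *ₗ x    ∎

      solveℕ : ∀ n k l → (n ℕ.+ l) ℕ.+ (k ℕ.+ l) ≡ ((n ℕ.+ k) ℕ.+ l) ℕ.+ l
      solveℕ = ℕSolver.solve 3 (λ n k l →
        (n ℕSolver.⊕ l) ℕSolver.⊕ (k ℕSolver.⊕ l)
          ℕSolver.⊜ ((n ℕSolver.⊕ k) ℕSolver.⊕ l) ℕSolver.⊕ l) ≡.refl

    *ᶠᴹ-distribˡ : ∀ q u v → q *ᶠᴹ (u +ᶠᴹ v) ≈ᶠᴹ q *ᶠᴹ u +ᶠᴹ q *ᶠᴹ v
    *ᶠᴹ-distribˡ (a /^ n) (x /^ k) (y /^ l) = ≈ᶠᴹ-expand n (begin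
      s ^ (n ℕ.+ l) *ₗ a *ₗ x +ᴹ s ^ (n ℕ.+ k) *ₗ a *ₗ y
        ≈⟨ +ᴹ-cong (pull l x) (pull k y) ⟩
      s ^ n *ₗ a *ₗ s ^ l *ₗ x +ᴹ s ^ n *ₗ a *ₗ s ^ k *ₗ y
        ≈⟨ *ₗ-distribˡ _ _ _ ⟨
      s ^ n *ₗ (a *ₗ s ^ l *ₗ x +ᴹ a *ₗ s ^ k *ₗ y)
        ≈⟨ *ₗ-congˡ (*ₗ-distribˡ _ _ _) ⟨
      s ^ n *ₗ a *ₗ (s ^ l *ₗ x +ᴹ s ^ k *ₗ y) ∎)
      (solveℕ n k l)
      where
      pull : ∀ l x → s ^ (n ℕ.+ l) *ₗ a *ₗ x ≈ᴹ s ^ n *ₗ a *ₗ s ^ l *ₗ x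
      pull l x = ≈ᴹ-trans (act-^+ n l _) (*ₗ-congˡ (*ₗ-comm _ _ x))

      solveℕ : ∀ n k l → (n ℕ.+ k) ℕ.+ (n ℕ.+ l) ≡ (n ℕ.+ (k ℕ.+ l)) ℕ.+ n
      solveℕ = ℕSolver.solve 3 (λ n k l →
        (n ℕSolver.⊕ k) ℕSolver.⊕ (n ℕSolver.⊕ l)
          ℕSolver.⊜ (n ℕSolver.⊕ (k ℕSolver.⊕ l)) ℕSolver.⊕ n) ≡.refl

  infix  4 _≈ᶠ_
  infixl 7 _*ᶠ_

  _≈ᶠ_ : Fraction R.Carrier → Fraction R.Carrier → Set ℓr
  _≈ᶠ_ = _≈ᶠᴹ_ ⟨module⟩

  _*ᶠ_ : Fraction R.Carrier → Fraction R.Carrier → Fraction R.Carrier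
  _*ᶠ_ = _*ᶠᴹ_ ⟨module⟩

  -ᶠ_ : Fraction R.Carrier → Fraction R.Carrier
  -ᶠ_ = -ᶠᴹ_ ⟨module⟩

  module _ {m ℓm : Level} (M : Module R m ℓm) where

    open Module M

    *ᶠᴹ-assoc : ∀ p q u → _≈ᶠᴹ_ M (_*ᶠᴹ_ M (p *ᶠ q) u) (_*ᶠᴹ_ M p (_*ᶠᴹ_ M q u))
    *ᶠᴹ-assoc (a /^ n) (b /^ k) (x /^ l) = ≈ᶠᴹ-equal M (*ₗ-assoc a b x) (ℕ.+-assoc n k l)

    *ᶠᴹ-cong : ∀ {p q u v} → p ≈ᶠ q → _≈ᶠᴹ_ M u v → _≈ᶠᴹ_ M (_*ᶠᴹ_ M p u) (_*ᶠᴹ_ M q v)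
    *ᶠᴹ-cong {a /^ n} {b /^ k} {x /^ l} {y /^ t} (cross j h) (cross j′ h′) = cross (j ℕ.+ j′) (begin
      s ^ (j ℕ.+ j′) *ₗ s ^ (k ℕ.+ t) *ₗ a *ₗ x               ≈⟨ regroup k t a x ⟩
      (s ^ j * (s ^ k * a)) *ₗ s ^ j′ *ₗ s ^ t *ₗ x           ≈⟨ *ₗ-cong h h′ ⟩
      (s ^ j * (s ^ n * b)) *ₗ s ^ j′ *ₗ s ^ l *ₗ y           ≈⟨ regroup n l b y ⟨
      s ^ (j ℕ.+ j′) *ₗ s ^ (n ℕ.+ l) *ₗ b *ₗ y               ∎)
      where
      open ≈-Reasoning ≈ᴹ-setoid
      open MonoidSolver R.*-commutativeMonoid using (solve; _⊕_; _⊜_)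

      regroup : ∀ k t a x → s ^ (j ℕ.+ j′) *ₗ s ^ (k ℕ.+ t) *ₗ a *ₗ x
                            ≈ᴹ (s ^ j * (s ^ k * a)) *ₗ s ^ j′ *ₗ s ^ t *ₗ x
      regroup k t a x = begin
        s ^ (j ℕ.+ j′) *ₗ s ^ (k ℕ.+ t) *ₗ a *ₗ x
          ≈⟨ *ₗ-cong (^-homo-* s j j′) (*ₗ-congʳ (^-homo-* s k t)) ⟩
        (s ^ j * s ^ j′) *ₗ (s ^ k * s ^ t) *ₗ a *ₗ x
          ≈⟨ ≈ᴹ-trans (*ₗ-assoc _ _ x) (*ₗ-congˡ (*ₗ-assoc _ _ x)) ⟨
        ((s ^ j * s ^ j′) * ((s ^ k * s ^ t) * a)) *ₗ x
          ≈⟨ *ₗ-congʳ (solve 5 (λ j j′ k t a →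
               (j ⊕ j′) ⊕ ((k ⊕ t) ⊕ a) ⊜ (j ⊕ (k ⊕ a)) ⊕ (j′ ⊕ t))
               R.refl (s ^ j) (s ^ j′) (s ^ k) (s ^ t) a) ⟩
        ((s ^ j * (s ^ k * a)) * (s ^ j′ * s ^ t)) *ₗ x
          ≈⟨ ≈ᴹ-trans (*ₗ-assoc _ _ x) (*ₗ-congˡ (*ₗ-assoc _ _ x)) ⟩
        (s ^ j * (s ^ k * a)) *ₗ s ^ j′ *ₗ s ^ t *ₗ x ∎

  *ᶠ-comm : ∀ p q → p *ᶠ q ≈ᶠ q *ᶠ p
  *ᶠ-comm (a /^ n) (b /^ k) = ≈ᶠᴹ-equal ⟨module⟩ (R.*-comm a b) (ℕ.+-comm n k)

  abstract
    isCommutativeRing : IsCommutativeRing _≈ᶠ_ _+ᶠ_ _*ᶠ_ -ᶠ_ 0ᶠ 1ᶠ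
    isCommutativeRing = record
      { isRing = record
        { +-isAbelianGroup = +ᶠᴹ-isAbelianGroup ⟨module⟩
        ; *-cong     = *ᶠᴹ-cong ⟨module⟩
        ; *-assoc    = *ᶠᴹ-assoc ⟨module⟩
        ; *-identity = *ᶠᴹ-identityˡ ⟨module⟩ ,
            λ p → ≈ᶠᴹ-trans ⟨module⟩ (*ᶠ-comm p 1ᶠ) (*ᶠᴹ-identityˡ ⟨module⟩ p)
        ; distrib    = *ᶠᴹ-distribˡ ⟨module⟩ , *ᶠᴹ-distribʳ ⟨module⟩
        }
      ; *-comm = *ᶠ-comm
      }

  localizedRing : CommutativeRing r ℓr
  localizedRing = record { isCommutativeRing = isCommutativeRing }

  abstract
    localizedModule-isLeftModule : {m ℓm : Level} (M : Module R m ℓm) →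
      IsLeftModule (CommutativeRing.ring localizedRing)
        (_≈ᶠᴹ_ M) (_+ᶠᴹ_ M) (0ᶠᴹ M) (-ᶠᴹ_ M) (_*ᶠᴹ_ M)
    localizedModule-isLeftModule M = record
      { isLeftSemimodule = record
        { +ᴹ-isCommutativeMonoid = IsAbelianGroup.isCommutativeMonoid (+ᶠᴹ-isAbelianGroup M)
        ; isPreleftSemimodule = record
          { *ₗ-cong      = *ᶠᴹ-cong M
          ; *ₗ-zeroˡ     = *ᶠᴹ-zeroˡ M
          ; *ₗ-distribʳ  = *ᶠᴹ-distribʳ M
          ; *ₗ-identityˡ = *ᶠᴹ-identityˡ M
          ; *ₗ-assoc     = *ᶠᴹ-assoc M
          ; *ₗ-zeroʳ     = *ᶠᴹ-zeroʳ M
          ; *ₗ-distribˡ  = *ᶠᴹ-distribˡ M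
          }
        }
      ; -ᴹ‿cong    = -ᶠᴹ-cong M
      ; -ᴹ‿inverse = IsAbelianGroup.inverse (+ᶠᴹ-isAbelianGroup M)
      }

  localizedModule : {m ℓm : Level} → Module R m ℓm → Module localizedRing m ℓm
  localizedModule M = record
    { Carrierᴹ = Fraction (Module.Carrierᴹ M)
    ; _≈ᴹ_ = _≈ᶠᴹ_ M
    ; _+ᴹ_ = _+ᶠᴹ_ M
    ; _*ₗ_ = _*ᶠᴹ_ M
    ; _*ᵣ_ = flip (_*ᶠᴹ_ M)
    ; 0ᴹ = 0ᶠᴹ M
    ; -ᴹ_ = -ᶠᴹ_ M
    ; isModule = IsModuleFromLeft.isModule {commutativeRing = localizedRing}
        (record { isLeftModule = localizedModule-isLeftModule M })
    }

open Localization public using (localizedRing; localizedModule)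

module _ {r ℓr b ℓb : Level} {R : CommutativeRing r ℓr} (B : CommutativeAlgebra R b ℓb)
         (f : Carrier R) where

  open CommutativeAlgebra B renaming (structureMap to φ)
  private
    module R where
      open CommutativeRing R public
      open Exp semiring public
    module B where
      open CommutativeRing ring public
      open Exp semiring public
    module φ = IsRingHomomorphism isRingHomomorphism

    φ-^ : ∀ n → φ (f R.^ n) B.≈ φ f B.^ n
    φ-^ ℕ.zero    = φ.1#-homo
    φ-^ (ℕ.suc n) = B.trans (φ.*-homo f (f R.^ n)) (B.*-congˡ (φ-^ n))

    φ-*^ : ∀ n a → φ (f R.^ n R.* a) B.≈ φ f B.^ n B.* φ a
    φ-*^ n a = B.trans (φ.*-homo (f R.^ n) a) (B.*-congʳ (φ-^ n))

    φ-**^ : ∀ j n a → φ (f R.^ j R.* (f R.^ n R.* a)) B.≈ φ f B.^ j B.* (φ f B.^ n B.* φ a)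
    φ-**^ j n a = B.trans (φ-*^ j _) (B.*-congˡ (φ-*^ n a))

  localizedMap : Fraction R.Carrier → Fraction B.Carrier
  localizedMap (a /^ n) = φ a /^ n

  abstract
    localizedMap-isRingHomomorphism : IsRingHomomorphism
      (CommutativeRing.rawRing (localizedRing R f))
      (CommutativeRing.rawRing (localizedRing ring (φ f))) localizedMap
    localizedMap-isRingHomomorphism = record
      { isSemiringHomomorphism = record
        { isNearSemiringHomomorphism = record
          { +-isMonoidHomomorphism = record
            { isMagmaHomomorphism = record
              { isRelHomomorphism = record
                { cong = λ { {a /^ n} {b /^ k} (Localization.cross j h) → Localization.cross j
                    (B.trans (B.sym (φ-**^ j k a)) (B.trans (φ.⟦⟧-cong h) (φ-**^ j n b))) } }
              ; homo = λ { (a /^ n) (b /^ k) → equal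
                    (B.trans (φ.+-homo _ _) (B.+-cong (φ-*^ k a) (φ-*^ n b))) }
              }
            ; ε-homo = equal φ.0#-homo
            }
          ; *-homo = λ { (a /^ n) (b /^ k) → equal (φ.*-homo a b) }
          }
        ; 1#-homo = equal φ.1#-homo
        }
      ; -‿homo = λ { (a /^ n) → equal (φ.-‿homo a) }
      }
      where
      equal : ∀ {x y n} → x B.≈ y → Localization._≈ᶠ_ ring (φ f) (x /^ n) (y /^ n)
      equal h = Localization.≈ᶠᴹ-equal ring (φ f) ⟨module⟩ h ≡.refl

  localizedAlgebra : CommutativeAlgebra (localizedRing R f) b ℓb
  localizedAlgebra = record
    { ring = localizedRing ring (φ f) ; isRingHomomorphism = localizedMap-isRingHomomorphism }

{-# OPTIONS --safe #-}
-- Let B be generated by x₁,…,x_n over A and M by v₁,…,v_k over B, and order the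
-- monomials x^u v_l of M by a monomial well-order.  Suppose that for every u in
-- a finite set U of monomials, f u is an A-combination of smaller monomials.
-- Then the monomials not divisible by any element of U span M[1/f].  If a x is a
-- combination of smaller monomials for such a monomial x, then U ∪ {x} and f a
-- are as U and f, so that f a = 0 by induction; the induction is well-founded
-- by Dickson's lemma.  Hence these monomials form a basis of M[1/f], the
-- relations indexed by U (a Gröbner basis) present M[1/f], and likewise
-- for B, so f = 0 by assumption.  The case U = ∅, f = 1 is the claim.
module Submission where

open import Algebra.Bundles using (CommutativeRing; CommutativeMonoid)
open import Algebra.Module.Bundles using (Module)
open import Algebra.Module.Construct.TensorUnit using (⟨module⟩)
open import Algebra.Module.Morphism.Structures using (IsModuleIsomorphism)
open import Algebra.Module.Structures using (IsLeftModule)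
open import Algebra.Module.Structures.Biased using (module IsModuleFromLeft)
open import Algebra.Morphism.Structures using (IsRingHomomorphism)
open import Data.Empty using (⊥)
open import Data.Fin.Base as Fin using (Fin; toℕ)
open import Data.List.Base as List using (List; []; _∷_; _++_; map; length)
open import Data.List.Membership.Propositional.Properties using (∈-lookup)
open import Data.List.Relation.Unary.All as All using (All; []; _∷_)
open import Data.List.Relation.Unary.Any as Any using (Any; here; there)
open import Data.Nat.Base as ℕ using (ℕ; _≤_; _∸_)
open import Data.Product.Base using (Σ; ∃; _×_; _,_; proj₁; proj₂; map₁; map₂)
open import Data.Sum.Base as Sum using (_⊎_; inj₁; inj₂; [_,_]; [_,_]′)
open import Data.Vec.Base as Vec using (Vec; []; _∷_; zipWith; lookup)
open import Data.Vec.Functional using (Vector)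
open import Data.Vec.Relation.Binary.Lex.Strict as Lex using (Lex-<; base; this; next)
open import Data.Vec.Relation.Binary.Pointwise.Inductive using (Pointwise-≡⇒≡; ≡⇒Pointwise-≡)
open import Function.Base using (_∘_; _on_; id; flip)
open import Induction.WellFounded using (WellFounded)
open import Level using (Level; _⊔_; suc; Lift; lift; lower)
open import Relation.Binary.Bundles using (Setoid)
open import Relation.Binary.Definitions using (Trichotomous; tri<; tri≈; tri>; Transitive)
open import Relation.Binary.PropositionalEquality as ≡ using (_≡_)
open import Relation.Binary.Structures using (IsEquivalence)
open import Relation.Nullary.Decidable as Dec using (Dec; yes; no)
open import Relation.Nullary.Negation using (¬_; contradiction)
open import Defs
import Algebra.Definitions.RawMonoid as RawMonoidDefs
import Algebra.Module.Properties as ModuleProperties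
import Algebra.Properties.AbelianGroup as AbelianGroupProperties
import Algebra.Properties.CommutativeMonoid.Sum as MonoidSum
import Algebra.Properties.CommutativeSemigroup as CommutativeSemigroupProperties
import Algebra.Properties.Semiring.Exp as Exp
import Data.Fin.Properties as Fin
import Data.List.Relation.Unary.Any.Properties as Any
import Data.Nat.Induction as ℕ
import Data.Nat.Properties as ℕ
import Data.Vec.Properties as Vec
import Induction.WellFounded as WF
import Relation.Binary.Construct.On as On
import Relation.Binary.Reasoning.Setoid as ≈-Reasoning

-- Almost full relations and Dickson's lemma

-- Classically one would test which leading coefficients vanish and invert one that does not. The
-- only decisions taken are comparisons of exponent vectors and divisibility by the finitely many
-- elements of `U`.
--
-- Independence also replaces confluence, so no S-polynomials appear. Rewriting is purely formal,
-- hence valid in every module in which the rules hold, in particular in a free object modulo the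
-- rules. If a sum vanishes in `M[1/f]`, so does its normal form, which by independence is formally
-- zero; hence the sum vanishes in the quotient as well, and the rules generate all relations.
--
-- The assumption on `f` concerns `B` and `M` at once. The induction therefore carries one set of
-- monomials for each of them, with a common `f`.

data AlmostFull {X : Set} (R : X → X → Set) : Set₁ where
  now   : (∀ x y → R x y) → AlmostFull R
  -- Once `x` has been read, a later `y` with `R x y` is a success, whatever `z` follows. The type
  -- is thus an inductive form of: every infinite sequence has some `x` before some `y` with
  -- `R x y`.
  later : (∀ x → AlmostFull (λ y z → R y z ⊎ R x y)) → AlmostFull R

private
  variable
    a ℓa b ℓb m ℓm b′ ℓb′ m′ ℓm′ i ℓi : Level
    X Y : Set

AlmostFull-mono : {R S : X → X → Set} → (∀ {x y} → R x y → S x y) → AlmostFull R → AlmostFull S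
AlmostFull-mono h (now r)   = now λ x y → h (r x y)
AlmostFull-mono h (later r) = later λ x → AlmostFull-mono (Sum.map h h) (r x)

AlmostFull-on : {R : X → X → Set} (g : Y → X) → AlmostFull R → AlmostFull (R on g)
AlmostFull-on g (now r)   = now λ x y → r (g x) (g y)
AlmostFull-on g (later r) = later λ x → AlmostFull-on g (r (g x))

-- The intuitionistic Ramsey theorem for two colours, after Vytiniotis,
-- Coquand and Wahlstedt.  It is proved for colours depending on no, one and
-- two elements in turn, each case being the induction step of the next.
module _ {X : Set} where

  private
    swap₂₃ : {P Q T : Set} → (P ⊎ Q) ⊎ T → (P ⊎ T) ⊎ Q
    swap₂₃ = [ Sum.map₁ inj₁ , inj₁ ∘ inj₂ ]

  -- `C` accumulates what already counts as success; `A` and `B` are what `R` and `S` yield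
  -- otherwise. As `A` mentions no element, it survives every unfolding of `R` unchanged, so `S`
  -- need not be unfolded.
  ∩-nullary : {R S : X → X → Set} {A B : Set} (C : X → X → Set) → AlmostFull R → AlmostFull S →
    (∀ {x y} → R x y → C x y ⊎ A) → (∀ {x y} → S x y → C x y ⊎ B) →
    AlmostFull (λ x y → C x y ⊎ A × B)
  ∩-nullary C (now r) s h k = AlmostFull-mono
    (λ {x} {y} sxy → [ inj₁ , (λ b → Sum.map₂ (_, b) (h (r x y))) ] (k sxy)) s
  ∩-nullary C (later r) s h k = later λ x → AlmostFull-mono
    [ Sum.map inj₁ inj₁ , inj₁ ∘ inj₂ ]
    (∩-nullary (λ y z → C y z ⊎ C x y) (r x) s
      [ Sum.map₁ inj₁ ∘ h , Sum.map₁ inj₂ ∘ h ] (Sum.map₁ inj₁ ∘ k))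

  ∩-unary : {R S : X → X → Set} {A B : X → Set} (C : X → X → Set) → AlmostFull R → AlmostFull S →
    (∀ {x y} → R x y → C x y ⊎ A x) → (∀ {x y} → S x y → C x y ⊎ B x) →
    AlmostFull (λ x y → C x y ⊎ A x × B x)
  ∩-unary C (now r) s h k = AlmostFull-mono
    (λ {x} {y} sxy → [ inj₁ , (λ b → Sum.map₂ (_, b) (h (r x y))) ] (k sxy)) s
  ∩-unary C (later r) (now s) h k = AlmostFull-mono
    (λ {x} {y} rxy → [ inj₁ , (λ a → Sum.map₂ (a ,_) (k (s x y))) ] (h rxy)) (later r)
  ∩-unary {A = A} {B} C (later r) (later s) h k = later λ x → AlmostFull-mono
    [ [ [ inj₁ ∘ inj₁ , inj₂ ∘ inj₁ ] , inj₁ ∘ inj₂ ] , inj₂ ∘ inj₂ ]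
    -- One recursive call advances `R` past `x` and leaves `A x`, the other advances `S` and leaves
    -- `B x`. With `x` fixed these depend on no element, so the previous case joins them to
    -- `A x × B x`.
    (∩-nullary (λ y z → (C y z ⊎ C x y) ⊎ A y × B y)
      (∩-unary (λ y z → (C y z ⊎ C x y) ⊎ A x) (r x) (later s)
        [ Sum.map₁ (inj₁ ∘ inj₁) ∘ h , inj₁ ∘ Sum.map₁ inj₂ ∘ h ]
        (Sum.map₁ (inj₁ ∘ inj₁) ∘ k))
      (∩-unary (λ y z → (C y z ⊎ C x y) ⊎ B x) (later r) (s x)
        (Sum.map₁ (inj₁ ∘ inj₁) ∘ h)
        [ Sum.map₁ (inj₁ ∘ inj₁) ∘ k , inj₁ ∘ Sum.map₁ inj₂ ∘ k ])
      swap₂₃ swap₂₃)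

  ∩-binary : {R S A B : X → X → Set} (C : X → X → Set) → AlmostFull R → AlmostFull S →
    (∀ {x y} → R x y → C x y ⊎ A x y) → (∀ {x y} → S x y → C x y ⊎ B x y) →
    AlmostFull (λ x y → C x y ⊎ A x y × B x y)
  ∩-binary C (now r) s h k = AlmostFull-mono
    (λ {x} {y} sxy → [ inj₁ , (λ b → Sum.map₂ (_, b) (h (r x y))) ] (k sxy)) s
  ∩-binary C (later r) (now s) h k = AlmostFull-mono
    (λ {x} {y} rxy → [ inj₁ , (λ a → Sum.map₂ (a ,_) (k (s x y))) ] (h rxy)) (later r)
  ∩-binary {A = A} {B} C (later r) (later s) h k = later λ x → AlmostFull-mono
    [ [ [ inj₁ ∘ inj₁ , inj₂ ∘ inj₁ ] , inj₁ ∘ inj₂ ] , inj₂ ∘ inj₂ ]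
    (∩-unary (λ y z → (C y z ⊎ C x y) ⊎ A y z × B y z)
      (∩-binary (λ y z → (C y z ⊎ C x y) ⊎ A x y) (r x) (later s)
        [ Sum.map₁ (inj₁ ∘ inj₁) ∘ h , inj₁ ∘ Sum.map₁ inj₂ ∘ h ]
        (Sum.map₁ (inj₁ ∘ inj₁) ∘ k))
      (∩-binary (λ y z → (C y z ⊎ C x y) ⊎ B x y) (later r) (s x)
        (Sum.map₁ (inj₁ ∘ inj₁) ∘ h)
        [ Sum.map₁ (inj₁ ∘ inj₁) ∘ k , inj₁ ∘ Sum.map₁ inj₂ ∘ k ])
      swap₂₃ swap₂₃)

  AlmostFull-∩ : {R S : X → X → Set} → AlmostFull R → AlmostFull S →
    AlmostFull (λ x y → R x y × S x y)
  AlmostFull-∩ r s = AlmostFull-mono [ (λ ()) , id ] (∩-binary (λ _ _ → ⊥) r s inj₂ inj₂)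

-- After `n` has been read, a pair can fail only if its first element lies below `n`. Reading such
-- an element lowers the bound, whence the induction on `n`.
≤-almostFull : AlmostFull _≤_
≤-almostFull = later λ n → below n
  where
  below : ∀ n → AlmostFull (λ x y → x ≤ y ⊎ n ≤ x)
  below ℕ.zero    = now λ _ _ → inj₂ ℕ.z≤n
  below (ℕ.suc n) = later step
    where
    step : ∀ x → AlmostFull (λ y z → (y ≤ z ⊎ n ℕ.< y) ⊎ (x ≤ y ⊎ n ℕ.< x))
    step x with x ℕ.≤? n
    ... | yes x≤n = AlmostFull-mono [ inj₁ ∘ inj₁ , inj₂ ∘ inj₁ ∘ ℕ.≤-trans x≤n ] (below n)
    ... | no  x≰n = now λ _ _ → inj₂ (inj₂ (ℕ.≰⇒> x≰n))

-- By antisymmetry equality is the intersection of `≤` and `≥`, and `m ∸_` turns the latter into a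
-- pullback of `≤`.
≡-almostFull : ∀ m → AlmostFull (_≡_ {A = Fin m})
≡-almostFull m = AlmostFull-mono
  (λ { {k} {l} (k≤l , m∸k≤m∸l) → Fin.toℕ-injective
         (ℕ.≤-antisym k≤l (ℕ.∸-cancelʳ-≤ (Fin.toℕ≤n l) m∸k≤m∸l)) })
  (AlmostFull-∩ (AlmostFull-on toℕ ≤-almostFull) (AlmostFull-on (λ k → m ∸ toℕ k) ≤-almostFull))

module _ {n : ℕ} where

  infixl 6 _⊕_

  _⊕_ : Vec ℕ n → Vec ℕ n → Vec ℕ n
  _⊕_ = zipWith ℕ._+_

infix 4 _≼_

-- Stated through the quotient `k` rather than entrywise, because reduction multiplies a rule by
-- this `k`.
_≼_ : {n : ℕ} → Vec ℕ n → Vec ℕ n → Set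
u ≼ w = ∃ λ k → k ⊕ u ≡ w

∷-≼ : ∀ {n a b} {u w : Vec ℕ n} → a ≤ b → u ≼ w → a ∷ u ≼ b ∷ w
∷-≼ {a = a} {b} a≤b (k , k⊕u≡w) = (b ∸ a) ∷ k , ≡.cong₂ _∷_ (ℕ.m∸n+n≡m a≤b) k⊕u≡w

≼-almostFull : ∀ n → AlmostFull (_≼_ {n})
≼-almostFull ℕ.zero    = now λ { [] [] → [] , ≡.refl }
≼-almostFull (ℕ.suc n) = AlmostFull-mono
  (λ { {_ ∷ _} {_ ∷ _} (a≤b , u≼w) → ∷-≼ a≤b u≼w })
  (AlmostFull-∩ (AlmostFull-on Vec.head ≤-almostFull) (AlmostFull-on Vec.tail (≼-almostFull n)))

≼-decidable : ∀ {n} (u w : Vec ℕ n) → Dec (u ≼ w)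
≼-decidable []      []      = yes ([] , ≡.refl)
≼-decidable (a ∷ u) (b ∷ w) = Dec.map′ (λ (a≤b , u≼w) → ∷-≼ a≤b u≼w)
  (λ { (c ∷ k , ≡.refl) → ℕ.m≤n+m a c , k , ≡.refl })
  (a ℕ.≤? b Dec.×-dec ≼-decidable u w)

-- (u , l) indexes the element x^u v_l of a module generated by v₁,…,v_m over
-- an algebra generated by x₁,…,x_n.
Index : ℕ → ℕ → Set
Index n m = Vec ℕ n × Fin m

module _ {n m : ℕ} where

  infixl 6 _⊹_
  infix  4 _∣_ _<_

  _⊹_ : Vec ℕ n → Index n m → Index n m
  k ⊹ (u , l) = k ⊕ u , l

  _∣_ : Index n m → Index n m → Set
  i ∣ j = ∃ λ k → k ⊹ i ≡ j

  ∣-almostFull : AlmostFull _∣_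
  ∣-almostFull = AlmostFull-mono (λ { ((k , ≡.refl) , ≡.refl) → k , ≡.refl })
    (AlmostFull-∩ (AlmostFull-on proj₁ (≼-almostFull n)) (AlmostFull-on proj₂ (≡-almostFull m)))

  _∣?_ : ∀ i j → Dec (i ∣ j)
  (u , k) ∣? (w , l) = Dec.map′ (λ { ((a , ≡.refl) , ≡.refl) → a , ≡.refl })
    (λ { (a , ≡.refl) → (a , ≡.refl) , ≡.refl })
    (≼-decidable u w Dec.×-dec k Fin.≟ l)

  -- Accessibility of `U` under extension by an index that no element of `U` divides. Recursion on
  -- it is the induction of the main argument.
  data Noetherian (U : List (Index n m)) : Set where
    noetherian : (∀ i → ¬ Any (_∣ i) U → Noetherian (i List.∷ U)) → Noetherian U

  -- Invariant: `R i j` gives `i ∣ j` unless `U` already divides `i`, which is excluded for each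
  -- index that is added. In the case `now` a second extension is therefore impossible; in the case
  -- `later` the disjunct `R i j` says that the new element `i` divides `j`.
  almostFull⇒noetherian : ∀ {R U} → AlmostFull R →
    (∀ {i j} → R i j → i ∣ j ⊎ Any (_∣ i) U) → Noetherian U
  almostFull⇒noetherian (now r) h = noetherian λ i i∉U → noetherian λ j j∉iU →
    contradiction ([ id , (λ i∈U → contradiction i∈U i∉U) ] (h (r i j))) (j∉iU ∘ here)
  almostFull⇒noetherian {U = U} (later r) h = noetherian λ i i∉U →
    almostFull⇒noetherian (r i)
      [ Sum.map₂ there ∘ h , (λ r′ → inj₂ ([ here , (λ i∈U → contradiction i∈U i∉U) ]′ (h r′))) ]

  dickson : Noetherian List.[]
  dickson = almostFull⇒noetherian ∣-almostFull inj₁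

  position : Index n m → Vec ℕ (ℕ.suc n)
  position (u , l) = toℕ l ∷ u

  position-injective : ∀ {i j} → position i ≡ position j → i ≡ j
  position-injective p≡q = ≡.cong₂ _,_ (Vec.∷-injectiveʳ p≡q) (Fin.toℕ-injective (Vec.∷-injectiveˡ p≡q))

  -- A position-over-term order: generators are compared first, then exponents lexicographically.
  -- Multiplication by a monomial leaves the first entry alone, and the fixed length of the vectors
  -- gives well-foundedness.
  _<_ : Index n m → Index n m → Set
  _<_ = Lex-< _≡_ ℕ._<_ on position

  <-trans : Transitive _<_
  <-trans = Lex.<-trans (IsEquivalence.isPartialEquivalence ≡.isEquivalence) (≡.resp₂ ℕ._<_) ℕ.<-trans

  <-cmp : Trichotomous _≡_ _<_
  <-cmp i j with Lex.<-cmp ≡.sym ℕ.<-cmp (position i) (position j)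
  ... | tri< a b c = tri< a (b ∘ ≡⇒Pointwise-≡ ∘ ≡.cong position) c
  ... | tri≈ a b c = tri≈ a (position-injective (Pointwise-≡⇒≡ b)) c
  ... | tri> a b c = tri> a (b ∘ ≡⇒Pointwise-≡ ∘ ≡.cong position) c

  <-wellFounded : WellFounded _<_
  <-wellFounded = On.wellFounded position
    (Lex.<-wellFounded ≡.trans (λ { ≡.refl → id }) ℕ.<-wellFounded)

  ⊹-monoʳ-< : ∀ k {i j} → i < j → k ⊹ i < k ⊹ j
  ⊹-monoʳ-< k (this l<l′ p)  = this l<l′ p
  ⊹-monoʳ-< k (next l≡l′ h) = next l≡l′ (mono k h)
    where
    mono : ∀ {d} (k : Vec ℕ d) {u w} → Lex-< _≡_ ℕ._<_ u w → Lex-< _≡_ ℕ._<_ (k ⊕ u) (k ⊕ w)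
    mono []      {[]} {[]} (base ())
    mono (c ∷ k) (this a<b p)  = this (ℕ.+-monoʳ-< c a<b) p
    mono (c ∷ k) (next a≡b h)  = next (≡.cong (c ℕ.+_) a≡b) (mono k h)

-- Linear combinations indexed by formal sums

module _ (A : CommutativeRing a ℓa) {I : Set i} where

  open CommutativeRing A

  infixr 7 _·_

  _·_ : Carrier → List (Carrier × I) → List (Carrier × I)
  c · p = map (map₁ (c *_)) p

  All-· : ∀ {P : I → Set ℓi} {c p} → All (P ∘ proj₂) p → All (P ∘ proj₂) (c · p)
  All-· []       = []
  All-· (h ∷ hs) = h ∷ All-· hs

module Combination {A : CommutativeRing a ℓa} (N : Module A m ℓm) where

  private
    module A = CommutativeRing A
  open Module N
  open ≈-Reasoning ≈ᴹ-setoid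
  open ModuleProperties N public using (inverseˡ-uniqueᴹ)
  open CommutativeSemigroupProperties
    (CommutativeMonoid.commutativeSemigroup (Module.+ᴹ-commutativeMonoid N))
    using (x∙yz≈y∙xz)

  module _ {I : Set i} where

    combine : (I → Carrierᴹ) → List (A.Carrier × I) → Carrierᴹ
    combine w = List.foldr (λ t y → proj₁ t *ₗ w (proj₂ t) +ᴹ y) 0ᴹ

    combine-cong : ∀ {w w′} → (∀ x → w x ≈ᴹ w′ x) → ∀ p → combine w p ≈ᴹ combine w′ p
    combine-cong h []            = ≈ᴹ-refl
    combine-cong h ((c , x) ∷ p) = +ᴹ-cong (*ₗ-congˡ (h x)) (combine-cong h p)

    combine-++ : ∀ w p q → combine w (p ++ q) ≈ᴹ combine w p +ᴹ combine w q
    combine-++ w []            q = ≈ᴹ-sym (+ᴹ-identityˡ _)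
    combine-++ w ((c , x) ∷ p) q =
      ≈ᴹ-trans (+ᴹ-congˡ (combine-++ w p q)) (≈ᴹ-sym (+ᴹ-assoc _ _ _))

    combine-· : ∀ w c p → combine w (_·_ A c p) ≈ᴹ c *ₗ combine w p
    combine-· w c []            = ≈ᴹ-sym (*ₗ-zeroʳ c)
    combine-· w c ((d , x) ∷ p) = ≈ᴹ-trans
      (+ᴹ-cong (*ₗ-assoc c d (w x)) (combine-· w c p)) (≈ᴹ-sym (*ₗ-distribˡ c _ _))

  combine-map : {I : Set i} {J : Set ℓi} (w : J → Carrierᴹ) (g : I → J) → ∀ p →
    combine w (map (map₂ g) p) ≡ combine (w ∘ g) p
  combine-map w g []            = ≡.refl
  combine-map w g ((c , x) ∷ p) = ≡.cong (c *ₗ w (g x) +ᴹ_) (combine-map w g p)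

  cancel : ∀ {x y} → x +ᴹ y ≈ᴹ 0ᴹ → x ≈ᴹ -ᴹ y
  cancel {x} {y} = inverseˡ-uniqueᴹ x y

  neg≈-1* : ∀ x → -ᴹ x ≈ᴹ (A.- A.1#) *ₗ x
  neg≈-1* x = ≈ᴹ-sym (cancel (begin
    (A.- A.1#) *ₗ x +ᴹ x            ≈⟨ +ᴹ-congˡ (*ₗ-identityˡ x) ⟨
    (A.- A.1#) *ₗ x +ᴹ A.1# *ₗ x    ≈⟨ *ₗ-distribʳ x _ _ ⟨
    (A.- A.1# A.+ A.1#) *ₗ x        ≈⟨ *ₗ-congʳ (A.-‿inverseˡ A.1#) ⟩
    A.0# *ₗ x                       ≈⟨ *ₗ-zeroˡ x ⟩
    0ᴹ                              ∎))

  module _ (I : Setoid i ℓi) (w : Setoid.Carrier I → Carrierᴹ)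
    (w-cong : ∀ {x y} → Setoid._≈_ I x y → w x ≈ᴹ w y) where

    open Free A I hiding (freeModule)

    combine-∼ : ∀ {p q} → p ∼ q → combine w p ≈ᴹ combine w q
    combine-∼ ∼-refl         = ≈ᴹ-refl
    combine-∼ (∼-sym h)      = ≈ᴹ-sym (combine-∼ h)
    combine-∼ (∼-trans h h′) = ≈ᴹ-trans (combine-∼ h) (combine-∼ h′)
    combine-∼ (∼-cons e f h) = +ᴹ-cong (*ₗ-cong e (w-cong f)) (combine-∼ h)
    combine-∼ ∼-swap         = x∙yz≈y∙xz _ _ _
    combine-∼ ∼-merge        =
      ≈ᴹ-trans (≈ᴹ-sym (+ᴹ-assoc _ _ _)) (+ᴹ-congʳ (≈ᴹ-sym (*ₗ-distribʳ _ _ _)))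
    combine-∼ ∼-drop         = ≈ᴹ-trans (+ᴹ-congʳ (*ₗ-zeroˡ _)) (+ᴹ-identityˡ _)

    combine-injective : (∀ p → combine w p ≈ᴹ 0ᴹ → p ∼ []) →
      ∀ {p q} → combine w p ≈ᴹ combine w q → p ∼ q
    combine-injective independent {p} {q} h =
      AbelianGroupProperties.x∙y⁻¹≈ε⇒x≈y (Module.+ᴹ-abelianGroup (freeModule A I)) p q
        (independent (p ++ negate q) (begin
          combine w (p ++ negate q)              ≈⟨ combine-++ w p (negate q) ⟩
          combine w p +ᴹ combine w (negate q)    ≈⟨ +ᴹ-congʳ h ⟩
          combine w q +ᴹ combine w (negate q)    ≈⟨ combine-++ w q (negate q) ⟨
          combine w (q ++ negate q)              ≈⟨ combine-∼ (negate-inverseʳ q) ⟩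
          0ᴹ                                     ∎))

    combine-isIsomorphism : (∀ p → combine w p ≈ᴹ 0ᴹ → p ∼ []) → (∀ y → ∃ λ p → combine w p ≈ᴹ y) →
      IsModuleIsomorphism (Module.rawModule (freeModule A I)) (Module.rawModule N) (combine w)
    combine-isIsomorphism independent spanning = record
      { isModuleMonomorphism = record
        { isModuleHomomorphism = record
          { isBimoduleHomomorphism = record
            { +ᴹ-isGroupHomomorphism = record
              { isMonoidHomomorphism = record
                { isMagmaHomomorphism = record
                  { isRelHomomorphism = record { cong = combine-∼ }
                  ; homo = combine-++ w
                  }
                ; ε-homo = ≈ᴹ-refl
                }
              ; ⁻¹-homo = λ p → cancel (≈ᴹ-trans (≈ᴹ-sym (combine-++ w (negate p) p))
                                  (combine-∼ (negate-inverseˡ p)))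
              }
            ; *ₗ-homo = combine-· w
            ; *ᵣ-homo = λ c p → ≈ᴹ-trans (combine-· w c p) (*ₗ-*ᵣ-coincident c _)
            }
          }
        ; injective = combine-injective independent
        }
      ; surjective = λ y → proj₁ (spanning y) ,
          λ h → ≈ᴹ-trans (combine-∼ h) (proj₂ (spanning y))
      }

    isFree : (∀ p → combine w p ≈ᴹ 0ᴹ → p ∼ []) → (∀ y → ∃ λ p → combine w p ≈ᴹ y) → IsFree i ℓi N
    isFree independent spanning = I , combine w , combine-isIsomorphism independent spanning

    module _ {n k : ℕ} (index : Setoid.Carrier I → Index n k)
      (index-injective : ∀ {x y} → index x ≡ index y → Setoid._≈_ I x y)
      (tight : ∀ x c p → All (λ t → index (proj₂ t) < index x) p →
               c *ₗ w x ≈ᴹ combine w p → c A.≈ A.0#) where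

      -- Merging terms of equal index leaves one term strictly above all others. Its coefficient may
      -- well be zero, so nothing has to be decided in `A`.
      extractLeading : ∀ t p → Σ FormalSum λ q → ∃ λ c → ∃ λ x →
        t ∷ p ∼ (c , x) ∷ q × All (λ u → index (proj₂ u) < index x) q × length q ℕ.≤ length p
      extractLeading (c , x) [] = [] , c , x , ∼-refl , [] , ℕ.z≤n
      extractLeading (c , x) (u ∷ p) with extractLeading u p
      ... | q , d , y , up∼dyq , q<y , |q|≤|p| with <-cmp (index x) (index y)
      ... | tri< x<y _ _ = (c , x) ∷ q , d , y ,
              ∼-trans (∼-prep _ up∼dyq) ∼-swap , x<y ∷ q<y , ℕ.s≤s |q|≤|p|
      ... | tri≈ _ x≡y _ = q , c A.+ d , y ,
              ∼-trans (∼-cons A.refl (index-injective x≡y) up∼dyq) ∼-merge , q<y , ℕ.m≤n⇒m≤1+n |q|≤|p|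
      ... | tri> _ _ y<x = (d , y) ∷ q , c , x ,
              ∼-prep _ up∼dyq , y<x ∷ All.map (λ z<y → <-trans z<y y<x) q<y , ℕ.s≤s |q|≤|p|

      -- Tightness kills the leading coefficient, and the rest is a shorter sum with the same value.
      -- That rest is not a subterm of `p`, so the recursion runs on a bound for the length.
      tight⇒independent : ∀ p → combine w p ≈ᴹ 0ᴹ → p ∼ []
      tight⇒independent p = go (length p) p ℕ.≤-refl
        where
        go : ∀ bound p → length p ℕ.≤ bound → combine w p ≈ᴹ 0ᴹ → p ∼ []
        go _           []      _                h = ∼-refl
        go (ℕ.suc bound) (t ∷ p) (ℕ.s≤s |p|≤bound) h with extractLeading t p
        ... | q , c , x , tp∼cxq , q<x , |q|≤|p| =
          ∼-trans tp∼q (go bound q (ℕ.≤-trans |q|≤|p| |p|≤bound) (≈ᴹ-trans (≈ᴹ-sym (combine-∼ tp∼q)) h))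
          where
          c≈0 : c A.≈ A.0#
          c≈0 = tight x c (_·_ A (A.- A.1#) q) (All-· A q<x) (begin
            c *ₗ w x                          ≈⟨ cancel (≈ᴹ-trans (≈ᴹ-sym (combine-∼ tp∼cxq)) h) ⟩
            -ᴹ combine w q                    ≈⟨ neg≈-1* _ ⟩
            (A.- A.1#) *ₗ combine w q         ≈⟨ combine-· w _ q ⟨
            combine w (_·_ A (A.- A.1#) q)    ∎)
          tp∼q : t ∷ p ∼ q
          tp∼q = ∼-trans tp∼cxq (∼-trans (∼-cons c≈0 (Setoid.refl I) ∼-refl) ∼-drop)

-- Constructions of modules

module _ (R : CommutativeRing a ℓa) where

  private
    module R = CommutativeRing R

  δ : ∀ {k} → Fin k → Vector R.Carrier k
  δ Fin.zero    Fin.zero    = R.1#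
  δ Fin.zero    (Fin.suc _) = R.0#
  δ (Fin.suc j) Fin.zero    = R.0#
  δ (Fin.suc j) (Fin.suc l) = δ j l

  δ-symmetric : ∀ {k} (j l : Fin k) → δ j l ≡ δ l j
  δ-symmetric Fin.zero    Fin.zero    = ≡.refl
  δ-symmetric Fin.zero    (Fin.suc _) = ≡.refl
  δ-symmetric (Fin.suc _) Fin.zero    = ≡.refl
  δ-symmetric (Fin.suc j) (Fin.suc l) = δ-symmetric j l

module _ {R : CommutativeRing a ℓa} (F : Module R m ℓm) where

  private
    module R = CommutativeRing R
  open Module F
  open Combination F using (neg≈-1*)
  open CommutativeSemigroupProperties (CommutativeMonoid.commutativeSemigroup +ᴹ-commutativeMonoid)
    using (interchange)
  open ≈-Reasoning ≈ᴹ-setoid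

  linearCombination-cong : ∀ {k} (c : Vector R.Carrier k) {v w : Vector Carrierᴹ k} →
    (∀ j → v j ≈ᴹ w j) → linearCombination F c v ≈ᴹ linearCombination F c w
  linearCombination-cong {ℕ.zero}  c h = ≈ᴹ-refl
  linearCombination-cong {ℕ.suc k} c h =
    +ᴹ-cong (*ₗ-congˡ (h Fin.zero)) (linearCombination-cong (c ∘ Fin.suc) (h ∘ Fin.suc))

  linearCombination-congˡ : ∀ {k} {c d : Vector R.Carrier k} (v : Vector Carrierᴹ k) →
    (∀ j → c j R.≈ d j) → linearCombination F c v ≈ᴹ linearCombination F d v
  linearCombination-congˡ {ℕ.zero}  v h = ≈ᴹ-refl
  linearCombination-congˡ {ℕ.suc k} v h =
    +ᴹ-cong (*ₗ-congʳ (h Fin.zero)) (linearCombination-congˡ (v ∘ Fin.suc) (h ∘ Fin.suc))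

  linearCombination-0 : ∀ {k} (v : Vector Carrierᴹ k) → linearCombination F (λ _ → R.0#) v ≈ᴹ 0ᴹ
  linearCombination-0 {ℕ.zero}  v = ≈ᴹ-refl
  linearCombination-0 {ℕ.suc k} v =
    ≈ᴹ-trans (+ᴹ-cong (*ₗ-zeroˡ _) (linearCombination-0 (v ∘ Fin.suc))) (+ᴹ-identityˡ 0ᴹ)

  linearCombination-+ : ∀ {k} (c d : Vector R.Carrier k) v →
    linearCombination F (λ j → c j R.+ d j) v ≈ᴹ linearCombination F c v +ᴹ linearCombination F d v
  linearCombination-+ {ℕ.zero}  c d v = ≈ᴹ-sym (+ᴹ-identityˡ 0ᴹ)
  linearCombination-+ {ℕ.suc k} c d v = ≈ᴹ-trans
    (+ᴹ-cong (*ₗ-distribʳ _ _ _) (linearCombination-+ (c ∘ Fin.suc) (d ∘ Fin.suc) (v ∘ Fin.suc)))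
    (interchange _ _ _ _)

  linearCombination-* : ∀ {k} s (c : Vector R.Carrier k) v →
    linearCombination F (λ j → s R.* c j) v ≈ᴹ s *ₗ linearCombination F c v
  linearCombination-* {ℕ.zero}  s c v = ≈ᴹ-sym (*ₗ-zeroʳ s)
  linearCombination-* {ℕ.suc k} s c v = ≈ᴹ-trans
    (+ᴹ-cong (*ₗ-assoc _ _ _) (linearCombination-* s (c ∘ Fin.suc) (v ∘ Fin.suc)))
    (≈ᴹ-sym (*ₗ-distribˡ _ _ _))

  linearCombination-δ : ∀ {k} j (v : Vector Carrierᴹ k) → linearCombination F (δ R j) v ≈ᴹ v j
  linearCombination-δ Fin.zero v = ≈ᴹ-trans
    (+ᴹ-cong (*ₗ-identityˡ _) (linearCombination-0 (v ∘ Fin.suc))) (+ᴹ-identityʳ _)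
  linearCombination-δ (Fin.suc j) v = ≈ᴹ-trans
    (+ᴹ-cong (*ₗ-zeroˡ _) (linearCombination-δ j (v ∘ Fin.suc))) (+ᴹ-identityˡ _)

  module _ {k : ℕ} (ρ : Vector Carrierᴹ k) where

    infix 4 _≡ρ_

    -- Equality in the quotient by the span of the `ρ j`, on the same carrier. A proof that an
    -- element is zero there carries its coefficients with respect to `ρ`, as a finite presentation
    -- requires.
    record _≡ρ_ (x y : Carrierᴹ) : Set (a ⊔ ℓm) where
      constructor congruent
      field
        coefficients : Vector R.Carrier k
        difference   : linearCombination F coefficients ρ +ᴹ y ≈ᴹ x

    ρ+y≈x⇒x≡ρy : ∀ j {x y} → ρ j +ᴹ y ≈ᴹ x → x ≡ρ y
    ρ+y≈x⇒x≡ρy j h = congruent (δ R j) (≈ᴹ-trans (+ᴹ-congʳ (linearCombination-δ j ρ)) h)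

    private
      ≈⇒≡ρ : ∀ {x y} → x ≈ᴹ y → x ≡ρ y
      ≈⇒≡ρ h = congruent (λ _ → R.0#)
        (≈ᴹ-trans (+ᴹ-congʳ (linearCombination-0 ρ)) (≈ᴹ-trans (+ᴹ-identityˡ _) (≈ᴹ-sym h)))

      ≡ρ-sym : ∀ {x y} → x ≡ρ y → y ≡ρ x
      ≡ρ-sym {x} {y} (congruent c h) = congruent (λ j → (R.- R.1#) R.* c j) (begin
        L (λ j → (R.- R.1#) R.* c j) +ᴹ x    ≈⟨ +ᴹ-cong (linearCombination-* _ c ρ) (≈ᴹ-sym h) ⟩
        (R.- R.1#) *ₗ L c +ᴹ (L c +ᴹ y)      ≈⟨ +ᴹ-congʳ (neg≈-1* _) ⟨
        -ᴹ L c +ᴹ (L c +ᴹ y)                 ≈⟨ +ᴹ-assoc _ _ _ ⟨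
        (-ᴹ L c +ᴹ L c) +ᴹ y                 ≈⟨ +ᴹ-congʳ (-ᴹ‿inverseˡ _) ⟩
        0ᴹ +ᴹ y                              ≈⟨ +ᴹ-identityˡ y ⟩
        y                                    ∎)
        where
        L : Vector R.Carrier k → Carrierᴹ
        L c = linearCombination F c ρ

      ≡ρ-trans : ∀ {x y z} → x ≡ρ y → y ≡ρ z → x ≡ρ z
      ≡ρ-trans (congruent c h) (congruent d h′) = congruent (λ j → c j R.+ d j)
        (≈ᴹ-trans (+ᴹ-congʳ (linearCombination-+ c d ρ))
          (≈ᴹ-trans (+ᴹ-assoc _ _ _) (≈ᴹ-trans (+ᴹ-congˡ h′) h)))

      ≡ρ-+-cong : ∀ {x x′ y y′} → x ≡ρ x′ → y ≡ρ y′ → x +ᴹ y ≡ρ x′ +ᴹ y′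
      ≡ρ-+-cong (congruent c h) (congruent d h′) = congruent (λ j → c j R.+ d j)
        (≈ᴹ-trans (+ᴹ-congʳ (linearCombination-+ c d ρ))
          (≈ᴹ-trans (interchange _ _ _ _) (+ᴹ-cong h h′)))

      ≡ρ-*-cong : ∀ {s t x y} → s R.≈ t → x ≡ρ y → s *ₗ x ≡ρ t *ₗ y
      ≡ρ-*-cong {s} {t} {x} {y} e (congruent c h) = congruent (λ j → s R.* c j)
        (≈ᴹ-trans (+ᴹ-cong (linearCombination-* s c ρ) (*ₗ-congʳ (R.sym e)))
          (≈ᴹ-trans (≈ᴹ-sym (*ₗ-distribˡ _ _ _)) (*ₗ-congˡ h)))

      ≡ρ-neg-cong : ∀ {x y} → x ≡ρ y → -ᴹ x ≡ρ -ᴹ y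
      ≡ρ-neg-cong h = ≡ρ-trans (≈⇒≡ρ (neg≈-1* _))
        (≡ρ-trans (≡ρ-*-cong R.refl h) (≈⇒≡ρ (≈ᴹ-sym (neg≈-1* _))))

    quotient : Module R m (a ⊔ ℓm)
    quotient = record
      { Carrierᴹ = Carrierᴹ
      ; _≈ᴹ_ = _≡ρ_
      ; _+ᴹ_ = _+ᴹ_
      ; _*ₗ_ = _*ₗ_
      ; _*ᵣ_ = flip _*ₗ_
      ; 0ᴹ = 0ᴹ
      ; -ᴹ_ = -ᴹ_
      ; isModule = IsModuleFromLeft.isModule {commutativeRing = R}
          (record { isLeftModule = quotient-isLeftModule })
      }
      where
      quotient-isLeftModule : IsLeftModule R.ring _≡ρ_ _+ᴹ_ 0ᴹ -ᴹ_ _*ₗ_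
      quotient-isLeftModule = record
        { isLeftSemimodule = record
          { +ᴹ-isCommutativeMonoid = record
            { isMonoid = record
              { isSemigroup = record
                { isMagma = record
                  { isEquivalence = record { refl = ≈⇒≡ρ ≈ᴹ-refl ; sym = ≡ρ-sym ; trans = ≡ρ-trans }
                  ; ∙-cong = ≡ρ-+-cong
                  }
                ; assoc = λ x y z → ≈⇒≡ρ (+ᴹ-assoc x y z)
                }
              ; identity = (λ x → ≈⇒≡ρ (+ᴹ-identityˡ x)) , (λ x → ≈⇒≡ρ (+ᴹ-identityʳ x))
              }
            ; comm = λ x y → ≈⇒≡ρ (+ᴹ-comm x y)
            }
          ; isPreleftSemimodule = record
            { *ₗ-cong      = ≡ρ-*-cong
            ; *ₗ-zeroˡ     = λ x → ≈⇒≡ρ (*ₗ-zeroˡ x)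
            ; *ₗ-distribʳ  = λ x s t → ≈⇒≡ρ (*ₗ-distribʳ x s t)
            ; *ₗ-identityˡ = λ x → ≈⇒≡ρ (*ₗ-identityˡ x)
            ; *ₗ-assoc     = λ s t x → ≈⇒≡ρ (*ₗ-assoc s t x)
            ; *ₗ-zeroʳ     = λ s → ≈⇒≡ρ (*ₗ-zeroʳ s)
            ; *ₗ-distribˡ  = λ s x y → ≈⇒≡ρ (*ₗ-distribˡ s x y)
            }
          }
        ; -ᴹ‿cong    = ≡ρ-neg-cong
        ; -ᴹ‿inverse = (λ x → ≈⇒≡ρ (-ᴹ‿inverseˡ x)) , (λ x → ≈⇒≡ρ (-ᴹ‿inverseʳ x))
        }

module _ (R : CommutativeRing a ℓa) (k : ℕ) where

  private
    module R = CommutativeRing R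

  vectorModule : Module R a ℓa
  vectorModule = record
    { Carrierᴹ = Vector R.Carrier k
    ; _≈ᴹ_ = λ x y → ∀ l → x l R.≈ y l
    ; _+ᴹ_ = λ x y l → x l R.+ y l
    ; _*ₗ_ = λ s x l → s R.* x l
    ; _*ᵣ_ = λ x s l → s R.* x l
    ; 0ᴹ = λ _ → R.0#
    ; -ᴹ_ = λ x l → R.- x l
    ; isModule = IsModuleFromLeft.isModule {commutativeRing = R} (record { isLeftModule = isLeftModule })
    }
    where
    isLeftModule : IsLeftModule R.ring (λ (x y : Vector R.Carrier k) → ∀ l → x l R.≈ y l)
      (λ x y l → x l R.+ y l) (λ _ → R.0#) (λ x l → R.- x l) (λ s x l → s R.* x l)
    isLeftModule = record
      { isLeftSemimodule = record
        { +ᴹ-isCommutativeMonoid = record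
          { isMonoid = record
            { isSemigroup = record
              { isMagma = record
                { isEquivalence = record
                  { refl = λ l → R.refl ; sym = λ h l → R.sym (h l) ; trans = λ h h′ l → R.trans (h l) (h′ l) }
                ; ∙-cong = λ h h′ l → R.+-cong (h l) (h′ l)
                }
              ; assoc = λ x y z l → R.+-assoc (x l) (y l) (z l)
              }
            ; identity = (λ x l → R.+-identityˡ (x l)) , (λ x l → R.+-identityʳ (x l))
            }
          ; comm = λ x y l → R.+-comm (x l) (y l)
          }
        ; isPreleftSemimodule = record
          { *ₗ-cong      = λ e h l → R.*-cong e (h l)
          ; *ₗ-zeroˡ     = λ x l → R.zeroˡ (x l)
          ; *ₗ-distribʳ  = λ x s t l → R.distribʳ (x l) s t
          ; *ₗ-identityˡ = λ x l → R.*-identityˡ (x l)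
          ; *ₗ-assoc     = λ s t x l → R.*-assoc s t (x l)
          ; *ₗ-zeroʳ     = λ s l → R.zeroʳ s
          ; *ₗ-distribˡ  = λ s x y l → R.distribˡ s (x l) (y l)
          }
        }
      ; -ᴹ‿cong    = λ h l → R.-‿cong (h l)
      ; -ᴹ‿inverse = (λ x l → R.-‿inverseˡ (x l)) , (λ x l → R.-‿inverseʳ (x l))
      }

  linearCombination-pointwise : ∀ {d} (c : Vector R.Carrier d) (ρ : Vector (Vector R.Carrier k) d) l →
    linearCombination vectorModule c ρ l ≡ linearCombination (⟨module⟩ {R = R}) c (λ j → ρ j l)
  linearCombination-pointwise {ℕ.zero}  c ρ l = ≡.refl
  linearCombination-pointwise {ℕ.suc d} c ρ l =
    ≡.cong (c Fin.zero R.* ρ Fin.zero l R.+_) (linearCombination-pointwise (c ∘ Fin.suc) (ρ ∘ Fin.suc) l)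

  vectorModule-isGeneratedBy-δ : IsGeneratedBy vectorModule (δ R)
  vectorModule-isGeneratedBy-δ c = c , λ l → begin
    linearCombination vectorModule c (δ R) l                        ≡⟨ linearCombination-pointwise c (δ R) l ⟩
    linearCombination (⟨module⟩ {R = R}) c (λ j → δ R j l)          ≈⟨ linearCombination-swap c (λ j → δ R j l) ⟩
    linearCombination (⟨module⟩ {R = R}) (λ j → δ R j l) c          ≈⟨ δ-sym l ⟩
    linearCombination (⟨module⟩ {R = R}) (δ R l) c                  ≈⟨ linearCombination-δ (⟨module⟩ {R = R}) l c ⟩
    c l                                                             ∎
    where
    open ≈-Reasoning R.setoid

    δ-sym : ∀ l → linearCombination (⟨module⟩ {R = R}) (λ j → δ R j l) c R.≈
                  linearCombination (⟨module⟩ {R = R}) (δ R l) c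
    δ-sym l = linearCombination-congˡ (⟨module⟩ {R = R}) c (λ j → R.reflexive (δ-symmetric R j l))

    linearCombination-swap : ∀ {d} (c c′ : Vector R.Carrier d) →
      linearCombination (⟨module⟩ {R = R}) c c′ R.≈ linearCombination (⟨module⟩ {R = R}) c′ c
    linearCombination-swap {ℕ.zero}  c c′ = R.refl
    linearCombination-swap {ℕ.suc d} c c′ =
      R.+-cong (R.*-comm _ _) (linearCombination-swap (c ∘ Fin.suc) (c′ ∘ Fin.suc))

-- Modules spanned by monomials

-- The intended examples are B-modules M = Σ B g_l with B = A[x₁,…,x_n], where
-- monomial u is x^u, and the elements x^u g_l span M over A.
record MonomialModule (A : CommutativeRing a ℓa) (b ℓb m ℓm : Level) (n k : ℕ)
  : Set (a ⊔ ℓa ⊔ suc (b ⊔ ℓb ⊔ m ⊔ ℓm)) where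
  field
    algebra : CommutativeAlgebra A b ℓb
  open CommutativeAlgebra algebra public
  private
    module A = CommutativeRing A
    module R = CommutativeRing ring
    module φ = IsRingHomomorphism isRingHomomorphism
  field
    module′    : Module ring m ℓm
    monomial   : Vec ℕ n → R.Carrier
    monomial-⊕ : ∀ u w → monomial (u ⊕ w) R.≈ monomial u R.* monomial w
    generator  : Fin k → Module.Carrierᴹ module′

  overBase : Module A m ℓm
  overBase = restrictScalars algebra module′

  open Module module′ public
  open Combination overBase public
  open ≈-Reasoning ≈ᴹ-setoid

  Sum : Set a
  Sum = List (A.Carrier × Index n k)

  element : Index n k → Carrierᴹ
  element (u , l) = monomial u *ₗ generator l

  eval : Sum → Carrierᴹ
  eval = combine element

  shift : Vec ℕ n → Sum → Sum
  shift w = map (map₂ (w ⊹_))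

  element-⊹ : ∀ w i → element (w ⊹ i) ≈ᴹ monomial w *ₗ element i
  element-⊹ w (u , l) = ≈ᴹ-trans (*ₗ-congʳ (monomial-⊕ w u)) (*ₗ-assoc _ _ _)

  eval-shift : ∀ w p → eval (shift w p) ≈ᴹ monomial w *ₗ eval p
  eval-shift w []            = ≈ᴹ-sym (*ₗ-zeroʳ _)
  eval-shift w ((c , i) ∷ p) = begin
    structureMap c *ₗ element (w ⊹ i) +ᴹ eval (shift w p)
      ≈⟨ +ᴹ-cong (*ₗ-congˡ (element-⊹ w i)) (eval-shift w p) ⟩
    structureMap c *ₗ monomial w *ₗ element i +ᴹ monomial w *ₗ eval p
      ≈⟨ +ᴹ-congʳ (*ₗ-comm _ _ _) ⟩
    monomial w *ₗ structureMap c *ₗ element i +ᴹ monomial w *ₗ eval p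
      ≈⟨ *ₗ-distribˡ _ _ _ ⟨
    monomial w *ₗ (structureMap c *ₗ element i +ᴹ eval p) ∎

  eval-[_] : ∀ i → eval ((A.1# , i) ∷ []) ≈ᴹ element i
  eval-[ i ] = ≈ᴹ-trans (+ᴹ-identityʳ _) (≈ᴹ-trans (*ₗ-congʳ φ.1#-homo) (*ₗ-identityˡ _))

  MonomialsSpan : Set (a ⊔ b ⊔ ℓb)
  MonomialsSpan = ∀ y → ∃ λ p → Combination.combine (algebraModule algebra) monomial p R.≈ y

  module _ (monomialsSpan : MonomialsSpan) (generated : IsGeneratedBy module′ generator) where

    private
      attach : Fin k → List (A.Carrier × Vec ℕ n) → Sum
      attach l = map (map₂ (_, l))

      eval-attach : ∀ l p → eval (attach l p) ≈ᴹ
        Combination.combine (algebraModule algebra) monomial p *ₗ generator l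
      eval-attach l []            = ≈ᴹ-sym (*ₗ-zeroˡ _)
      eval-attach l ((c , u) ∷ p) = ≈ᴹ-trans
        (+ᴹ-cong (≈ᴹ-sym (*ₗ-assoc _ _ _)) (eval-attach l p)) (≈ᴹ-sym (*ₗ-distribʳ _ _ _))

      expand : ∀ {d} (c : Vector R.Carrier d) (g : Fin d → Fin k) →
        ∃ λ p → eval p ≈ᴹ linearCombination module′ c (generator ∘ g)
      expand {ℕ.zero}  c g = [] , ≈ᴹ-refl
      expand {ℕ.suc d} c g with monomialsSpan (c Fin.zero) | expand (c ∘ Fin.suc) (g ∘ Fin.suc)
      ... | p , p≈c₀ | q , q≈ = attach (g Fin.zero) p ++ q ,
        ≈ᴹ-trans (combine-++ element (attach (g Fin.zero) p) q)
          (+ᴹ-cong (≈ᴹ-trans (eval-attach _ p) (*ₗ-congʳ p≈c₀)) q≈)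

    spanning : ∀ y → ∃ λ p → eval p ≈ᴹ y
    spanning y with generated y
    ... | c , c≈y = map₂ (λ h → ≈ᴹ-trans h c≈y) (expand c id)

-- Rewriting rules lead j ↦ tail j, as given by the leading terms of a Gröbner
-- basis; each of them also applies to the multiples of lead j.
module Reduction {A : CommutativeRing a ℓa} {n k d : ℕ} (i ℓi : Level)
  (lead : Fin d → Index n k)
  (tail : Fin d → List (CommutativeRing.Carrier A × Index n k))
  (bounded : ∀ j → All (λ t → proj₂ t < lead j) (tail j)) where

  private
    module A = CommutativeRing A

  IsStandard : Index n k → Set
  IsStandard x = ∀ j → ¬ (lead j ∣ x)

  -- The basis to be. Equality ignores the proofs of standardness, and the lifts move it to the
  -- levels prescribed by `IsFree`.
  Standard : Setoid i ℓi
  Standard = record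
    { Carrier = Lift i (∃ IsStandard)
    ; _≈_ = λ x y → Lift ℓi (proj₁ (lower x) ≡ proj₁ (lower y))
    ; isEquivalence = record
      { refl  = lift ≡.refl
      ; sym   = λ h → lift (≡.sym (lower h))
      ; trans = λ h h′ → lift (≡.trans (lower h) (lower h′))
      }
    }

  open Free A Standard using (FormalSum; _∼_)

  index : Setoid.Carrier Standard → Index n k
  index = proj₁ ∘ lower

  infix 4 _⇓_ _⇓*_

  -- No module occurs here, so that one derivation can be interpreted in every module satisfying the
  -- rules. The relation need not be single-valued: any applicable rule may be used.
  data _⇓_ : Index n k → FormalSum → Set (a ⊔ i)
  data _⇓*_ : List (A.Carrier × Index n k) → FormalSum → Set (a ⊔ i)

  data _⇓_ where
    standard : ∀ x → index x ⇓ (A.1# , x) ∷ []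
    reduce   : ∀ j w {q} → map (map₂ (w ⊹_)) (tail j) ⇓* q → w ⊹ lead j ⇓ q

  data _⇓*_ where
    []  : [] ⇓* []
    _∷_ : ∀ {c x p q q′} → x ⇓ q → p ⇓* q′ → (c , x) ∷ p ⇓* _·_ A c q ++ q′

  shiftedTail⇓ : ∀ w {x} → (∀ {y} → y < w ⊹ x → ∃ (y ⇓_)) →
    ∀ p → All (λ t → proj₂ t < x) p → ∃ (map (map₂ (w ⊹_)) p ⇓*_)
  shiftedTail⇓ w rec []            []          = _ , []
  shiftedTail⇓ w rec ((c , y) ∷ p) (y<x ∷ p<x) =
    _ , proj₂ (rec (⊹-monoʳ-< w y<x)) ∷ proj₂ (shiftedTail⇓ w rec p p<x)

  normalForm : ∀ x → ∃ (x ⇓_)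
  normalForm = WF.All.wfRec <-wellFounded _ _ step
    where
    step : ∀ x → (∀ {y} → y < x → ∃ (y ⇓_)) → ∃ (x ⇓_)
    -- Standardness is decidable because there are finitely many rules. Multiplication respects
    -- `_<_`, so the shifted tail lies below `x` and the recursion applies to it.
    step x rec with Fin.any? (λ j → lead j ∣? x)
    ... | no  x∉U = _ , standard (lift (x , λ j j∣x → x∉U (j , j∣x)))
    ... | yes (j , w , ≡.refl) =
      _ , reduce j w (proj₂ (shiftedTail⇓ w rec (tail j) (bounded j)))

  normalForm* : ∀ p → ∃ (p ⇓*_)
  normalForm* []            = _ , []
  normalForm* ((c , x) ∷ p) = _ , proj₂ (normalForm x) ∷ proj₂ (normalForm* p)

  Satisfies : MonomialModule A b ℓb m ℓm n k → Set ℓm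
  Satisfies N = ∀ j → element (lead j) ≈ᴹ eval (tail j)
    where open MonomialModule N

  evalStandard : (N : MonomialModule A b ℓb m ℓm n k) → FormalSum → MonomialModule.Carrierᴹ N
  evalStandard N = MonomialModule.combine N (MonomialModule.element N ∘ index)

  module _ (N : MonomialModule A b ℓb m ℓm n k) (satisfies : Satisfies N) where

    open MonomialModule N
    open IsRingHomomorphism isRingHomomorphism using (1#-homo)

    ⇓-sound  : ∀ {x q} → x ⇓ q → element x ≈ᴹ evalStandard N q
    ⇓*-sound : ∀ {p q} → p ⇓* q → eval p ≈ᴹ evalStandard N q
    ⇓-sound (standard x) = ≈ᴹ-sym eval-[ index x ]
    ⇓-sound (reduce j w t⇓q) =
      ≈ᴹ-trans (element-⊹ w (lead j)) (≈ᴹ-trans (*ₗ-congˡ (satisfies j))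
        (≈ᴹ-trans (≈ᴹ-sym (eval-shift w (tail j))) (⇓*-sound t⇓q)))
    ⇓*-sound []                  = ≈ᴹ-refl
    ⇓*-sound (_∷_ {c} {q = q} {q′} x⇓q p⇓q′) = ≈ᴹ-trans
      (+ᴹ-cong (≈ᴹ-trans (*ₗ-congˡ (⇓-sound x⇓q)) (≈ᴹ-sym (combine-· _ c q))) (⇓*-sound p⇓q′))
      (≈ᴹ-sym (combine-++ _ (_·_ A c q) q′))

  element-cong : (N : MonomialModule A b ℓb m ℓm n k) → ∀ x y → Setoid._≈_ Standard x y →
    MonomialModule._≈ᴹ_ N (MonomialModule.element N (index x)) (MonomialModule.element N (index y))
  element-cong N x y (lift h) = MonomialModule.≈ᴹ-reflexive N (≡.cong (MonomialModule.element N) h)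

  -- Only `x` has to be standard; the smaller monomials in `p` are arbitrary. Independence of the
  -- standard monomials is the special case needed below.
  IsTight : MonomialModule A b ℓb m ℓm n k → Set (a ⊔ ℓa ⊔ ℓm)
  IsTight N = ∀ x c p → IsStandard x → All (λ t → proj₂ t < x) p →
    structureMap c *ₗ element x ≈ᴹ eval p → c A.≈ A.0#
    where open MonomialModule N

  module _ (N : MonomialModule A b ℓb m ℓm n k) (satisfies : Satisfies N) (tight : IsTight N) where

    private
      module N = MonomialModule N
    open N using (_≈ᴹ_; 0ᴹ; ≈ᴹ-trans; ≈ᴹ-sym; ≈ᴹ-reflexive)

    independent : ∀ q → evalStandard N q ≈ᴹ 0ᴹ → q ∼ []
    independent = N.tight⇒independent Standard _ (λ {x} {y} → element-cong N x y) index lift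
      λ x c p p<x h → tight (index x) c (map (map₂ index) p) (proj₂ (lower x)) (All-index p<x)
        (≈ᴹ-trans h (≈ᴹ-sym (≈ᴹ-reflexive (N.combine-map N.element index p))))
      where
      All-index : ∀ {x} {p : FormalSum} → All (λ t → index (proj₂ t) < x) p →
                  All (λ t → proj₂ t < x) (map (map₂ index) p)
      All-index []       = []
      All-index (h ∷ hs) = h ∷ All-index hs

    -- The normal form of `p` vanishes in `N`, hence is formally zero, hence vanishes in `F` too.
    -- With `F` a free object modulo the relators, this says that the relators generate all
    -- relations of `N`.
    relationsFollow : (F : MonomialModule A b′ ℓb′ m′ ℓm′ n k) → Satisfies F →
      ∀ p → N.eval p ≈ᴹ 0ᴹ → MonomialModule._≈ᴹ_ F (MonomialModule.eval F p) (MonomialModule.0ᴹ F)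
    relationsFollow F satisfiesF p h with normalForm* p
    ... | q , p⇓q = F.≈ᴹ-trans (⇓*-sound F satisfiesF p⇓q)
      (F.combine-∼ Standard _ (λ {x} {y} → element-cong F x y)
        (independent q (≈ᴹ-trans (≈ᴹ-sym (⇓*-sound N satisfies p⇓q)) h)))
      where module F = MonomialModule F

    free : N.MonomialsSpan → IsGeneratedBy N.module′ N.generator → IsFree i ℓi N.overBase
    free span generated = N.isFree Standard _ (λ {x} {y} → element-cong N x y) independent λ y →
      let p , p≈y = N.spanning span generated y
          q , p⇓q = normalForm* p
      in q , ≈ᴹ-trans (≈ᴹ-sym (⇓*-sound N satisfies p⇓q)) p≈y

  relator : Fin d → List (A.Carrier × Index n k)
  relator j = (A.1# , lead j) ∷ _·_ A (A.- A.1#) (tail j)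

  module _ (N : MonomialModule A b ℓb m ℓm n k) where

    open MonomialModule N

    eval-relator : ∀ j → eval (relator j) +ᴹ eval (tail j) ≈ᴹ element (lead j)
    eval-relator j = begin
      eval (relator j) +ᴹ t                                        ≈⟨ +ᴹ-assoc _ _ _ ⟩
      structureMap A.1# *ₗ e +ᴹ (eval (_·_ A (A.- A.1#) (tail j)) +ᴹ t)
        ≈⟨ +ᴹ-cong (≈ᴹ-trans (≈ᴹ-sym (+ᴹ-identityʳ _)) eval-[ lead j ])
             (+ᴹ-congʳ (≈ᴹ-trans (combine-· element _ (tail j)) (≈ᴹ-sym (neg≈-1* t)))) ⟩
      e +ᴹ (-ᴹ t +ᴹ t)                                             ≈⟨ +ᴹ-congˡ (-ᴹ‿inverseˡ t) ⟩
      e +ᴹ 0ᴹ                                                      ≈⟨ +ᴹ-identityʳ e ⟩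
      e                                                            ∎
      where
      open ≈-Reasoning ≈ᴹ-setoid
      t e : Carrierᴹ
      t = eval (tail j)
      e = element (lead j)

    relator-vanishes : Satisfies N → ∀ j → eval (relator j) ≈ᴹ 0ᴹ
    relator-vanishes satisfies j = +ᴹ-cancelʳ (eval (tail j)) _ _
      (≈ᴹ-trans (eval-relator j) (≈ᴹ-trans (satisfies j) (≈ᴹ-sym (+ᴹ-identityˡ _))))
      where
      open AbelianGroupProperties +ᴹ-abelianGroup using () renaming (∙-cancelʳ to +ᴹ-cancelʳ)

    modRelators : MonomialModule A b ℓb m (b ⊔ ℓm) n k
    modRelators = record
      { algebra    = algebra
      ; module′    = quotient module′ (eval ∘ relator)
      ; monomial   = monomial
      ; monomial-⊕ = monomial-⊕
      ; generator  = generator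
      }

    modRelators-satisfies : Satisfies modRelators
    modRelators-satisfies j = ρ+y≈x⇒x≡ρy module′ (eval ∘ relator) j (eval-relator j)

    vanishing⇒combination : ∀ p → MonomialModule._≈ᴹ_ modRelators (MonomialModule.eval modRelators p) 0ᴹ →
      ∃ λ h → linearCombination module′ h (eval ∘ relator) ≈ᴹ eval p
    vanishing⇒combination p (congruent h h·ρ≈p) =
      h , ≈ᴹ-trans (≈ᴹ-sym (+ᴹ-identityʳ _)) h·ρ≈p

  module _ (N : MonomialModule A b ℓb m ℓm n k) (satisfies : Satisfies N) (tight : IsTight N) where

    open MonomialModule N

    private
      vectors : MonomialModule A b ℓb b ℓb n k
      vectors = record
        { algebra    = algebra
        ; module′    = vectorModule ring k
        ; monomial   = monomial
        ; monomial-⊕ = monomial-⊕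
        ; generator  = δ ring
        }
      module F = MonomialModule vectors

      project : ∀ p → linearCombination module′ (F.eval p) generator ≈ᴹ eval p
      project []                  = linearCombination-0 module′ generator
      project ((c , u , l) ∷ p) = ≈ᴹ-trans
        (linearCombination-+ module′ (structureMap c F.*ₗ F.element (u , l)) (F.eval p) generator)
        (+ᴹ-cong
          (≈ᴹ-trans (linearCombination-* module′ (structureMap c) (F.element (u , l)) generator) (*ₗ-congˡ
            (≈ᴹ-trans (linearCombination-* module′ (monomial u) (δ ring l) generator) (*ₗ-congˡ
              (linearCombination-δ module′ l generator)))))
          (project p))

    -- A syzygy `c` is an element of the free module on `k` generators, so it can be written as a
    -- sum `p` of monomials there. As `p` evaluates to zero in `N`, it vanishes modulo the relators.
    finitelyPresented : MonomialsSpan → IsGeneratedBy module′ generator → IsFinitelyPresented module′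
    finitelyPresented span generated =
      k , generator , generated , d , F.eval ∘ relator ,
      (λ j → ≈ᴹ-trans (project (relator j)) (relator-vanishes N satisfies j)) , complete
      where
      open CommutativeRing ring using (trans; reflexive)

      complete : ∀ c → linearCombination module′ c generator ≈ᴹ 0ᴹ →
        Σ (Vector (CommutativeRing.Carrier ring) d) λ h → ∀ l → CommutativeRing._≈_ ring
          (linearCombination (⟨module⟩ {R = ring}) h (λ j → F.eval (relator j) l)) (c l)
      complete c c·g≈0 =
        let p , p≈c = F.spanning span (vectorModule-isGeneratedBy-δ ring k) c
            h , h·ρ≈p = vanishing⇒combination vectors p (relationsFollow N satisfies tight
              (modRelators vectors) (modRelators-satisfies vectors) p
              (≈ᴹ-trans (≈ᴹ-sym (project p))
                (≈ᴹ-trans (linearCombination-congˡ module′ generator p≈c) c·g≈0)))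
        in h , λ l → trans
             (reflexive (≡.sym (linearCombination-pointwise ring k h (F.eval ∘ relator) l)))
             (trans (h·ρ≈p l) (p≈c l))

-- Polynomial rings and finite presentation of algebras

module _ (A : CommutativeRing a ℓa) (n : ℕ) where

  private
    module A = CommutativeRing A
    module P = CommutativeRing (polynomialRing A n)
  open MonoidAlgebra A (monomials n)
  open Free A (CommutativeMonoid.setoid (monomials n)) hiding (freeModule)

  polynomialAlgebra : CommutativeAlgebra A a (a ⊔ ℓa)
  polynomialAlgebra = record
    { ring = polynomialRing A n
    ; structureMap = λ c → (c , ε) ∷ []
    ; isRingHomomorphism = record
      { isSemiringHomomorphism = record
        { isNearSemiringHomomorphism = record
          { +-isMonoidHomomorphism = record
            { isMagmaHomomorphism = record
              { isRelHomomorphism = record { cong = λ c≈d → ∼-cons c≈d ≡.refl ∼-refl }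
              ; homo = λ c d → ∼-sym ∼-merge
              }
            ; ε-homo = ∼-drop
            }
          ; *-homo = λ c d → ∼-cons A.refl (≡.sym (proj₁ identity ε)) ∼-refl
          }
        ; 1#-homo = ∼-refl
        }
      ; -‿homo = λ c → ∼-refl
      }
    }
    where open CommutativeMonoid (monomials n) using (ε; identity)

  open CommutativeMonoid (monomials n) using (ε; identityˡ)

  polynomials : MonomialModule A a (a ⊔ ℓa) a (a ⊔ ℓa) n 1
  polynomials = record
    { algebra    = polynomialAlgebra
    ; module′    = ⟨module⟩
    ; monomial   = λ u → (A.1# , u) ∷ []
    ; monomial-⊕ = λ u w → ∼-cons (A.sym (A.*-identityˡ A.1#)) ≡.refl ∼-refl
    ; generator  = λ _ → one
    }

  private
    module F = MonomialModule polynomials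

  toSum : P.Carrier → F.Sum
  toSum = map (map₂ (_, Fin.zero))

  fromSum : F.Sum → P.Carrier
  fromSum = map (map₂ proj₁)

  eval-fromSum : ∀ p → F.eval p ∼ fromSum p
  eval-fromSum []                = ∼-refl
  eval-fromSum ((c , u , l) ∷ p) = ++-cong
    (∼-trans (⊛-congʳ ((c , ε) ∷ []) (P.*-identityʳ ((A.1# , u) ∷ [])))
      (∼-cons (A.*-identityʳ c) (identityˡ u) ∼-refl))
    (eval-fromSum p)

  toSum-fromSum : ∀ p → toSum (fromSum p) ≡ p
  toSum-fromSum []                       = ≡.refl
  toSum-fromSum ((c , u , Fin.zero) ∷ p) = ≡.cong ((c , u , Fin.zero) ∷_) (toSum-fromSum p)

  fromSum-toSum : ∀ p → fromSum (toSum p) ≡ p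
  fromSum-toSum []            = ≡.refl
  fromSum-toSum ((c , u) ∷ p) = ≡.cong ((c , u) ∷_) (fromSum-toSum p)

module _ {A : CommutativeRing a ℓa} {n d : ℕ} (i ℓi : Level)
  (lead : Fin d → Index n 1)
  (tail : Fin d → List (CommutativeRing.Carrier A × Index n 1))
  (bounded : ∀ j → All (λ t → proj₂ t < lead j) (tail j)) where

  open Reduction {A = A} i ℓi lead tail bounded

  private
    module F = MonomialModule (polynomials A n)
    module P = CommutativeRing (polynomialRing A n)

  module _ (B : CommutativeAlgebra A b ℓb)
    (x : Vector (CommutativeRing.Carrier (CommutativeAlgebra.ring B)) n) where

    private
      module B = CommutativeRing (CommutativeAlgebra.ring B)

    -- The argument of `finitelyPresented` with the polynomial ring as the free object, where the
    -- span of the relators is an ideal. The two kernel assumptions let `N` use monomials that agree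
    -- with products of powers of `x` without being these expressions.
    finitelyPresentedAlgebra : IsGeneratedAsAlgebraBy B x →
      (N : MonomialModule A b′ ℓb′ m ℓm n 1) → Satisfies N → IsTight N → let open MonomialModule N in
      (∀ p → evaluate B x p B.≈ B.0# → eval (toSum A n p) ≈ᴹ 0ᴹ) →
      (∀ p → eval (toSum A n p) ≈ᴹ 0ᴹ → evaluate B x p B.≈ B.0#) →
      IsOfFinitePresentation B
    finitelyPresentedAlgebra generated N satisfies tight kernel⇒ kernel⇐ =
      n , x , generated , d , g ,
      (λ j → kernel⇐ (g j) (N.≈ᴹ-trans (N.≈ᴹ-reflexive (≡.cong N.eval (toSum-fromSum A n (relator j))))
               (relator-vanishes N satisfies j))) ,
      λ p p≈0 →
        let h , h·ρ≈p = vanishing⇒combination (polynomials A n) (toSum A n p)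
              (relationsFollow N satisfies tight (modRelators (polynomials A n))
                (modRelators-satisfies (polynomials A n)) (toSum A n p) (kernel⇒ p p≈0))
        in h , P.trans (linearCombination-cong (⟨module⟩ {R = polynomialRing A n}) h
                     (λ j → P.sym (eval-fromSum A n (relator j))))
             (P.trans h·ρ≈p (P.trans (eval-fromSum A n (toSum A n p)) (P.reflexive (fromSum-toSum A n p))))
      where
      module N = MonomialModule N

      g : Vector P.Carrier d
      g j = fromSum A n (relator j)

-- Algebras of finite type

module _ {A : CommutativeRing a ℓa} (B : CommutativeAlgebra A b ℓb) {n : ℕ} where

  open CommutativeAlgebra B using (ring; structureMap)
  private
    module A = CommutativeRing A
    module B = CommutativeRing ring
  open Exp B.semiring using (_^_; ^-homo-*)
  open MonoidSum B.*-commutativeMonoid using ()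
    renaming (sum to product; sum-cong-≋ to product-cong; ∑-distrib-+ to product-distrib-*)

  powerProduct : Vector B.Carrier n → Vec ℕ n → B.Carrier
  powerProduct x u = product (λ j → x j ^ lookup u j)

  powerProduct-⊕ : ∀ x u w → powerProduct x (u ⊕ w) B.≈ powerProduct x u B.* powerProduct x w
  powerProduct-⊕ x u w = B.trans
    (product-cong (λ j → B.trans (B.reflexive (≡.cong (x j ^_) (Vec.lookup-zipWith ℕ._+_ j u w)))
                           (^-homo-* (x j) (lookup u j) (lookup w j))))
    (product-distrib-* (λ j → x j ^ lookup u j) (λ j → x j ^ lookup w j))

  evaluate≈combine : ∀ x {μ : Vec ℕ n → B.Carrier} → (∀ u → powerProduct x u B.≈ μ u) →
    ∀ p → evaluate B x p B.≈ Combination.combine (algebraModule B) μ p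
  evaluate≈combine x h []            = B.refl
  evaluate≈combine x h ((c , u) ∷ p) = B.+-cong (B.*-congˡ (h u)) (evaluate≈combine x h p)

  powerProducts : Vector B.Carrier n → {k : ℕ} (M : Module ring m ℓm) → Vector (Module.Carrierᴹ M) k →
    MonomialModule A b ℓb m ℓm n k
  powerProducts x M g = record
    { algebra    = B
    ; module′    = M
    ; monomial   = powerProduct x
    ; monomial-⊕ = powerProduct-⊕ x
    ; generator  = g
    }

  powerProducts-span : ∀ x {k} (M : Module ring m ℓm) (g : Vector (Module.Carrierᴹ M) k) →
    IsGeneratedAsAlgebraBy B x → MonomialModule.MonomialsSpan (powerProducts x M g)
  powerProducts-span x M g generated y =
    let p , p≈y = generated y in p , B.trans (B.sym (evaluate≈combine x (λ _ → B.refl) p)) p≈y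

-- Localization

module _ {A : CommutativeRing a ℓa} (B : CommutativeAlgebra A b ℓb) (f : CommutativeRing.Carrier A)
  (M : Module (CommutativeAlgebra.ring B) m ℓm) where

  open CommutativeAlgebra B using (ring; structureMap)
  open Module M
  private
    module A = CommutativeRing A
    module B = CommutativeRing ring
    module M′ = Module (localizedModule ring (structureMap f) M)
    s = structureMap f
  open Exp B.semiring using (_^_)
  open Localization ring s using (≈ᶠᴹ-equal; ≈ᶠᴹ-expand)

  0/^ : ∀ t → 0ᴹ /^ 0 M′.≈ᴹ 0ᴹ /^ t
  0/^ t = ≈ᶠᴹ-expand M t (≈ᴹ-sym (*ₗ-zeroʳ _)) ≡.refl

  -- The exponent `t + 0` is that of the product of a scalar `c /^ t` with a vector `v /^ 0`.
  +-/^ : ∀ x y t → x /^ (t ℕ.+ 0) M′.+ᴹ y /^ t M′.≈ᴹ (x +ᴹ y) /^ t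
  +-/^ x y t = M′.≈ᴹ-sym (≈ᶠᴹ-expand M t
    (≈ᴹ-trans (+ᴹ-congˡ (*ₗ-congʳ (B.reflexive (≡.cong (s ^_) (ℕ.+-identityʳ t)))))
      (≈ᴹ-sym (*ₗ-distribˡ _ _ _)))
    (≡.cong (ℕ._+ t) (ℕ.+-identityʳ t)))

  combine-/^ : {I : Set i} (w : I → Carrierᴹ) → ∀ t p →
    Combination.combine (restrictScalars (localizedAlgebra B f) (localizedModule ring s M))
      (λ x → w x /^ 0) (map (map₁ (_/^ t)) p)
    M′.≈ᴹ Combination.combine (restrictScalars B M) w p /^ t
  combine-/^ w t []            = 0/^ t
  combine-/^ w t ((c , x) ∷ p) = M′.≈ᴹ-trans (M′.+ᴹ-congˡ (combine-/^ w t p)) (+-/^ _ _ t)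

  linearCombination-/^ : ∀ {k} (c : Vector B.Carrier k) v t →
    linearCombination (localizedModule ring s M) (λ l → c l /^ t) (λ l → v l /^ 0)
    M′.≈ᴹ linearCombination M c v /^ t
  linearCombination-/^ {ℕ.zero}  c v t = 0/^ t
  linearCombination-/^ {ℕ.suc k} c v t =
    M′.≈ᴹ-trans (M′.+ᴹ-congˡ (linearCombination-/^ (c ∘ Fin.suc) (v ∘ Fin.suc) t)) (+-/^ _ _ t)

module LocalizedMonomials {A : CommutativeRing a ℓa} {n k : ℕ} (N : MonomialModule A b ℓb m ℓm n k)
  (f : CommutativeRing.Carrier A) where

  open MonomialModule N
  private
    module A where
      open CommutativeRing A public
      open Exp semiring public using (_^_; ^-homo-*)
    module B = CommutativeRing ring
    module φ = IsRingHomomorphism isRingHomomorphism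
    s = structureMap f
  open Exp B.semiring using (_^_)
  open Localization ring s using (≈ᶠᴹ-equal; ≈ᶠᴹ-expand; cross)

  localized : MonomialModule (localizedRing A f) b ℓb m ℓm n k
  localized = record
    { algebra    = localizedAlgebra algebra f
    ; module′    = localizedModule ring s module′
    ; monomial   = λ u → monomial u /^ 0
    ; monomial-⊕ = λ u w → ≈ᶠᴹ-equal ⟨module⟩ (monomial-⊕ u w) ≡.refl
    ; generator  = λ l → generator l /^ 0
    }

  private
    module N′ = MonomialModule localized

    φ-^ : ∀ t → structureMap (f A.^ t) B.≈ s ^ t
    φ-^ ℕ.zero    = φ.1#-homo
    φ-^ (ℕ.suc t) = B.trans (φ.*-homo f (f A.^ t)) (B.*-congˡ (φ-^ t))

    φ-^* : ∀ t c y → structureMap (f A.^ t A.* c) *ₗ y ≈ᴹ s ^ t *ₗ structureMap c *ₗ y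
    φ-^* t c y = ≈ᴹ-trans (*ₗ-congʳ (φ.*-homo _ c)) (≈ᴹ-trans (*ₗ-assoc _ _ y) (*ₗ-congʳ (φ-^ t)))

    eval-^· : ∀ t p → eval (_·_ A (f A.^ t) p) ≈ᴹ s ^ t *ₗ eval p
    eval-^· t p = ≈ᴹ-trans (combine-· element _ p) (*ₗ-congʳ (φ-^ t))

  localized-span : MonomialsSpan → N′.MonomialsSpan
  localized-span span (y /^ t) with span y
  ... | p , p≈y = map (map₁ (_/^ t)) p , 
    B′.trans (combine-/^ algebra f ⟨module⟩ monomial t p) (≈ᶠᴹ-equal ⟨module⟩ p≈y ≡.refl)
    where module B′ = CommutativeRing N′.ring

  localized-generated : IsGeneratedBy module′ generator → IsGeneratedBy N′.module′ N′.generator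
  localized-generated generated (y /^ t) with generated y
  ... | c , c·g≈y = (λ l → c l /^ t) ,
    N′.≈ᴹ-trans (linearCombination-/^ algebra f module′ c generator t) (≈ᶠᴹ-equal module′ c·g≈y ≡.refl)

  -- Only coefficients change, so the bound by `x` survives the passage from `A[1/f]` to `A`.
  clearDenominators : ∀ {x} p → All (λ t → proj₂ t < x) p →
    ∃ λ q → ∃ λ t → All (λ t → proj₂ t < x) q × N′.eval p N′.≈ᴹ eval q /^ t
  clearDenominators []                 []          = [] , 0 , [] , N′.≈ᴹ-refl
  clearDenominators ((c /^ t , y) ∷ p) (y<x ∷ p<x) with clearDenominators p p<x
  ... | q , t′ , q<x , p≈q =
    (f A.^ t′ A.* c , y) ∷ _·_ A (f A.^ (t ℕ.+ 0)) q , t ℕ.+ 0 ℕ.+ t′ , y<x ∷ All-· A q<x ,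
    N′.≈ᴹ-trans (N′.+ᴹ-congˡ p≈q) (≈ᶠᴹ-equal module′
      (≈ᴹ-sym (+ᴹ-cong (φ-^* t′ c _) (eval-^· (t ℕ.+ 0) q))) ≡.refl)

  IsReducible : List (Index n k) → Set (a ⊔ ℓm)
  IsReducible = All (λ u → ∃ λ p → All (λ t → proj₂ t < u) p × s *ₗ element u ≈ᴹ eval p)

  -- The trace over `A` of tightness over `A[1/f]`, in the form in which the induction delivers it:
  -- as vanishing of the next multiplier `f * c`.
  IsTightOutside : List (Index n k) → Set (a ⊔ ℓa ⊔ ℓm)
  IsTightOutside U = ∀ x c p → ¬ Any (_∣ x) U → All (λ t → proj₂ t < x) p →
    structureMap c *ₗ element x ≈ᴹ eval p → f A.* c A.≈ A.0#

  module LocalizedRules (i ℓi : Level) (U : List (Index n k)) (reducible : IsReducible U) where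

    lead : Fin (length U) → Index n k
    lead = List.lookup U

    private
      rule : ∀ j → ∃ λ p → All (λ t → proj₂ t < lead j) p × s *ₗ element (lead j) ≈ᴹ eval p
      rule j = All.lookup reducible (∈-lookup j)

    -- The relation `f u = p` divided by `f`, whence the exponent 1 on every coefficient.
    tail : Fin (length U) → N′.Sum
    tail j = map (map₁ (_/^ 1)) (proj₁ (rule j))

    bounded : ∀ j → All (λ t → proj₂ t < lead j) (tail j)
    bounded j = All-/^ (proj₁ (proj₂ (rule j)))
      where
      All-/^ : ∀ {x : Index n k} {p} → All (λ t → proj₂ t < x) p →
               All (λ t → proj₂ t < x) (map (map₁ (_/^ 1)) p)
      All-/^ []       = []
      All-/^ (h ∷ hs) = h ∷ All-/^ hs

    open Reduction {A = localizedRing A f} i ℓi lead tail bounded public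

    satisfies : Satisfies localized
    satisfies j = N′.≈ᴹ-trans (cross 0 (*ₗ-congˡ (begin
        (s B.* B.1#) *ₗ element (lead j)     ≈⟨ *ₗ-congʳ (B.*-identityʳ s) ⟩
        s *ₗ element (lead j)                ≈⟨ proj₂ (proj₂ (rule j)) ⟩
        eval (proj₁ (rule j))                ≈⟨ *ₗ-identityˡ _ ⟨
        B.1# *ₗ eval (proj₁ (rule j))        ∎)))
      (N′.≈ᴹ-sym (combine-/^ algebra f module′ element 1 (proj₁ (rule j))))
      where open ≈-Reasoning ≈ᴹ-setoid

    tight : IsTightOutside U → IsTight localized
    tight tightOutside x (c /^ t) p x-standard p<x h = annihilated (clearDenominators p p<x)
      where
      open CommutativeRing (localizedRing A f) using (_≈_; 0#)

      annihilated : (∃ λ q → ∃ λ t → All (λ t → proj₂ t < x) q × N′.eval p N′.≈ᴹ eval q /^ t) →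
        c /^ t ≈ 0#
      annihilated (q , t′ , q<x , p≈q) with N′.≈ᴹ-trans h p≈q
      -- The exponent `j` comes from the equality of fractions, `t′` from clearing the denominators
      -- of `p`, and the successor from the factor `f` in `IsTightOutside`.
      ... | cross j cx≈q = Localization.cross (ℕ.suc (j ℕ.+ t′)) (begin
        (f A.* f A.^ (j ℕ.+ t′)) A.* (A.1# A.* c)        ≈⟨ A.*-assoc _ _ _ ⟩
        f A.* (f A.^ (j ℕ.+ t′) A.* (A.1# A.* c))
          ≈⟨ A.*-congˡ (A.*-cong (A.^-homo-* f j t′) (A.*-identityˡ c)) ⟩
        f A.* ((f A.^ j A.* f A.^ t′) A.* c)             ≈⟨ A.*-congˡ (A.*-assoc _ _ _) ⟩
        f A.* (f A.^ j A.* (f A.^ t′ A.* c))             ≈⟨ vanishes ⟩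
        A.0#                                             ≈⟨ A.trans (A.*-congˡ (A.zeroʳ _)) (A.zeroʳ _) ⟨
        (f A.* f A.^ (j ℕ.+ t′)) A.* (f A.^ t A.* A.0#)  ∎)
        where
        open ≈-Reasoning A.setoid
        vanishes : f A.* (f A.^ j A.* (f A.^ t′ A.* c)) A.≈ A.0#
        vanishes = tightOutside x _ (_·_ A (f A.^ j) (_·_ A (f A.^ (t ℕ.+ 0)) q))
          (λ x∈U → x-standard (Any.index x∈U) (Any.lookup-index x∈U))
          (All-· A (All-· A q<x))
          (≈ᴹ-trans (φ-^* j _ _) (≈ᴹ-trans (*ₗ-congˡ (φ-^* t′ c _)) (≈ᴹ-trans cx≈q
            (≈ᴹ-sym (≈ᴹ-trans (eval-^· j (_·_ A (f A.^ (t ℕ.+ 0)) q)) (*ₗ-congˡ (eval-^· (t ℕ.+ 0) q)))))))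

-- Generic freeness

module _ {A : CommutativeRing a ℓa} {n k : ℕ} (N : MonomialModule A b ℓb m ℓm n k) where

  open MonomialModule N
  open LocalizedMonomials N using (IsReducible)
  private
    module A = CommutativeRing A
    module φ = IsRingHomomorphism isRingHomomorphism

  module _ (f c : A.Carrier) where

    structureMap-* : ∀ y → structureMap (f A.* c) *ₗ y ≈ᴹ structureMap f *ₗ structureMap c *ₗ y
    structureMap-* y = ≈ᴹ-trans (*ₗ-congʳ (φ.*-homo f c)) (*ₗ-assoc _ _ y)

    reducible-* : ∀ {U} → IsReducible f U → IsReducible (f A.* c) U
    reducible-* = All.map λ { {u} (p , p<u , fu≈p) → _·_ A c p , All-· A p<u ,
      ≈ᴹ-trans (structureMap-* _) (≈ᴹ-trans (*ₗ-comm _ _ _)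
        (≈ᴹ-trans (*ₗ-congˡ fu≈p) (≈ᴹ-sym (combine-· element c p)))) }

    -- The new relation is multiplied by `f` and the old ones by `c`, which gives all of them the
    -- same multiplier `f * c`.
    reducible-∷ : ∀ {U} x p → All (λ t → proj₂ t < x) p → structureMap c *ₗ element x ≈ᴹ eval p →
      IsReducible f U → IsReducible (f A.* c) (x ∷ U)
    reducible-∷ x p p<x cx≈p reducible =
      (_·_ A f p , All-· A p<x ,
        ≈ᴹ-trans (structureMap-* _) (≈ᴹ-trans (*ₗ-congˡ cx≈p) (≈ᴹ-sym (combine-· element f p))))
      ∷ reducible-* reducible

module _ {A : CommutativeRing a ℓa} (B : CommutativeAlgebra A b ℓb) {n : ℕ}
  (x : Vector (CommutativeRing.Carrier (CommutativeAlgebra.ring B)) n) where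

  open CommutativeAlgebra B
  private
    module A = CommutativeRing A
    module B = CommutativeRing ring

  unit : Vector B.Carrier 1
  unit _ = B.1#

  unit-generates : IsGeneratedBy (⟨module⟩ {R = ring}) unit
  unit-generates y = (λ _ → y) , B.trans (B.+-identityʳ _) (B.*-identityʳ y)

  -- `B` as a module over itself with generator 1, so that freeness of `B[1/f]` is an instance of
  -- the result for modules.
  regular : MonomialModule A b ℓb b ℓb n 1
  regular = powerProducts B x ⟨module⟩ unit

  module _ {k : ℕ} (M : Module ring m ℓm) (g : Vector (Module.Carrierᴹ M) k)
    (f : A.Carrier) (U : List (Index n k)) (i ℓi : Level) where

    private
      N : MonomialModule A b ℓb m ℓm n k
      N = powerProducts B x M g
    open LocalizedMonomials N f

    module _ (reducible : IsReducible U) (tightOutside : IsTightOutside U)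
      (generatedB : IsGeneratedAsAlgebraBy B x) (generatedM : IsGeneratedBy M g) where

      open LocalizedRules i ℓi U reducible

      localizedModule-isFree :
        IsFree i ℓi (restrictScalars (localizedAlgebra B f) (localizedModule ring (structureMap f) M))
      localizedModule-isFree = free localized satisfies (tight tightOutside)
        (localized-span (powerProducts-span B x M g generatedB)) (localized-generated generatedM)

      localizedModule-isFinitelyPresented : IsFinitelyPresented (localizedModule ring (structureMap f) M)
      localizedModule-isFinitelyPresented = finitelyPresented localized satisfies (tight tightOutside)
        (localized-span (powerProducts-span B x M g generatedB)) (localized-generated generatedM)

  module _ (f : A.Carrier) (U : List (Index n 1)) (i ℓi : Level) where

    open LocalizedMonomials regular f

    private
      B′ : CommutativeAlgebra (localizedRing A f) b ℓb
      B′ = localizedAlgebra B f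
      module N′ = MonomialModule localized
      module B′ = CommutativeRing (CommutativeAlgebra.ring B′)
      open Exp B.semiring using (_^_)
      open Exp B′.semiring using () renaming (_^_ to _^′_)
      open Localization ring (structureMap f) using (≈ᶠᴹ-equal)

      x′ : Vector B′.Carrier n
      x′ j = x j /^ 0

      ^-/^0 : ∀ y t → (y /^ 0) ^′ t B′.≈ (y ^ t) /^ 0
      ^-/^0 y ℕ.zero    = B′.refl
      ^-/^0 y (ℕ.suc t) = B′.*-congˡ (^-/^0 y t)

      product-/^0 : ∀ {d} (y : Vector B.Carrier d) (y′ : Vector B′.Carrier d) → (∀ j → y′ j B′.≈ y j /^ 0) →
        RawMonoidDefs.sum B′.*-rawMonoid y′ B′.≈ RawMonoidDefs.sum B.*-rawMonoid y /^ 0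
      product-/^0 {ℕ.zero}  y y′ h = B′.refl
      product-/^0 {ℕ.suc d} y y′ h = B′.*-cong (h Fin.zero) (product-/^0 (y ∘ Fin.suc) (y′ ∘ Fin.suc) (h ∘ Fin.suc))

      -- `evaluate` multiplies within `B[1/f]`, whereas the monomials of `localized` are fractions
      -- of products formed in `B`.
      powerProduct-/^0 : ∀ u → powerProduct B′ x′ u B′.≈ powerProduct B x u /^ 0
      powerProduct-/^0 u = product-/^0 _ _ (λ j → ^-/^0 (x j) (lookup u j))

      evaluate≈combine′ : ∀ p → evaluate B′ x′ p B′.≈ Combination.combine (algebraModule B′) N′.monomial p
      evaluate≈combine′ = evaluate≈combine B′ x′ powerProduct-/^0

      evaluate≈eval : ∀ p → evaluate B′ x′ p B′.≈ N′.eval (toSum (localizedRing A f) n p)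
      evaluate≈eval p = begin
        evaluate B′ x′ p                                  ≈⟨ evaluate≈combine′ p ⟩
        N′.combine N′.monomial p                          ≈⟨ N′.combine-cong (λ u → B′.*-identityʳ _) p ⟨
        N′.combine (λ u → N′.monomial u B′.* B′.1#) p     ≡⟨ N′.combine-map N′.element (_, Fin.zero) p ⟨
        N′.eval (toSum (localizedRing A f) n p)           ∎
        where open ≈-Reasoning B′.setoid

      generated′ : IsGeneratedAsAlgebraBy B x → IsGeneratedAsAlgebraBy B′ x′
      generated′ generatedB y =
        let p , p≈y = localized-span (powerProducts-span B x ⟨module⟩ unit generatedB) y
        in p , B′.trans (evaluate≈combine′ p) p≈y

    localizedAlgebra-isOfFinitePresentation : IsReducible U → IsTightOutside U →
      IsGeneratedAsAlgebraBy B x → IsOfFinitePresentation (localizedAlgebra B f)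
    localizedAlgebra-isOfFinitePresentation reducible tightOutside generatedB =
      finitelyPresentedAlgebra i ℓi lead tail bounded B′ x′ (generated′ generatedB)
        localized satisfies (tight tightOutside)
        (λ p h → B′.trans (B′.sym (evaluate≈eval p)) h) (λ p h → B′.trans (evaluate≈eval p) h)
      where open LocalizedRules i ℓi U reducible

mainTheorem4 : {a ℓa b ℓb m ℓm i ℓi : Level}
    (A : CommutativeRing a ℓa) → IsReduced A →
    (B : CommutativeAlgebra A b ℓb) → IsOfFiniteType B →
    (M : Module (CommutativeAlgebra.ring B) m ℓm) → IsFinitelyGenerated M →
    let module A = CommutativeRing A
        module B = CommutativeAlgebra B
    in
    (∀ f →
      (IsFree i ℓi (algebraModule (localizedAlgebra B f)) ×
       IsFree i ℓi (restrictScalars (localizedAlgebra B f)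
                     (localizedModule B.ring (B.structureMap f) M))) ×
      IsOfFinitePresentation (localizedAlgebra B f) ×
      IsFinitelyPresented (localizedModule B.ring (B.structureMap f) M) →
      f A.≈ A.0#) →
    A.1# A.≈ A.0#
mainTheorem4 {i = i} {ℓi} A _ B (n , x , generatedB) M (k , g , generatedM) onlyZero =
  vanishes dickson dickson A.1# [] []
  where
  module A = CommutativeRing A

  NB : MonomialModule A _ _ _ _ n 1
  NB = regular B x
  NM : MonomialModule A _ _ _ _ n k
  NM = powerProducts B x M g

  -- `U` serves `B` and `V` serves `M`. A relation in either module extends its own set and keeps
  -- the other, so each recursive call descends in one of the two derivations. Its conclusion for
  -- `f * c` is exactly the tightness required to apply `onlyZero` to `f`.
  vanishes : ∀ {U V} → Noetherian U → Noetherian V → ∀ f →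
    LocalizedMonomials.IsReducible NB f U → LocalizedMonomials.IsReducible NM f V → f A.≈ A.0#
  vanishes {U} {V} (noetherian extendU) (noetherian extendV) f reducibleU reducibleV = onlyZero f
    ( ( localizedModule-isFree B x ⟨module⟩ (unit B x) f U i ℓi reducibleU tightU generatedB (unit-generates B x)
      , localizedModule-isFree B x M g f V i ℓi reducibleV tightV generatedB generatedM )
    , localizedAlgebra-isOfFinitePresentation B x f U i ℓi reducibleU tightU generatedB
    , localizedModule-isFinitelyPresented B x M g f V i ℓi reducibleV tightV generatedB generatedM )
    where
    tightU : LocalizedMonomials.IsTightOutside NB f U
    tightU y c p y∉U p<y cy≈p = vanishes (extendU y y∉U) (noetherian extendV) (f A.* c)
      (reducible-∷ NB f c y p p<y cy≈p reducibleU) (reducible-* NM f c reducibleV)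
    tightV : LocalizedMonomials.IsTightOutside NM f V
    tightV y c p y∉V p<y cy≈p = vanishes (noetherian extendU) (extendV y y∉V) (f A.* c)
      (reducible-* NB f c reducibleU) (reducible-∷ NM f c y p p<y cy≈p reducibleV)
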